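{- Let $n\ge 2$ and let $W$ be the Coxeter group of type $D_n$ with generator set $S$ and Coxeter graph $\Gamma_{D_n}$. Let $v\in W$ and consider the induced subgraph $\Gamma_{D_n}[S\setminus\mathrm{Des}(v)]$. Let $b_0$ be the connected component of this induced subgraph containing a vertex of degree three in it (with $b_0=\emptyset$ if no such vertex exists), and let $b_1,\ldots,b_k$ be the remaining connected components. Then the number of Boolean intervals $[v,w]$ in the right weak order of $W$ with minimal element $v$ and arbitrary maximal element $w$ (including $w=v$) is $$d_{|b_0|}\cdot\prod_{i=1}^k F_{|b_i|+2},$$ where $d_0=1$, $d_1=1$, $d_2=4$, $d_m=d_{m-1}+d_{m-2}$ for $m\ge3$, and $F_\ell$ is the $\ell$-th Fibonacci number with $F_1=F_2=1$.
   Context: Type $D_n$: generators $S=\{s_1,\ldots,s_{n-2},s_{n-1},s'_{n-1}\}$ with $m(s_i,s_{i+1})=3$ for $1\le i\le n-2$, $m(s_{n-2},s'_{n-1})=3$, and all other pairs of distinct generators commuting ($m=2$). The Coxeter graph $\Gamma_{D_n}$ has vertex set $S$ and an edge between $s,s'$ iff $m(s,s')\ge 3$. Right weak order: $u\le w$ iff $\ell(w)=\ell(u)+\ell(u^{ -1}w)$. $\mathrm{Des}(v)=\{s\in S:\ell(vs)<\ell(v)\}$. An interval is Boolean if it is isomorphic to the lattice of subsets of a finite set. -}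

module Defs where

open import Data.Nat using (ℕ; zero; suc; _+_; _*_; _∸_; _≤_; _<_)
open import Data.Nat.Properties using (_≟_; _<?_)
open import Data.Bool using (Bool; true; false; if_then_else_; _xor_)
open import Data.Fin using (Fin; toℕ)
open import Data.Fin.Subset using (Subset; _⊆_)
open import Data.List using (List; []; _∷_; map; upTo; foldl; length)
open import Data.List.Membership.Propositional using (_∈_)
open import Data.List.Relation.Unary.Any using (Any)
open import Data.List.Relation.Unary.All using (All)
open import Data.List.Relation.Unary.AllPairs using (AllPairs)
open import Data.List.Relation.Unary.Unique.Propositional using (Unique)
open import Data.Product using (Σ; ∃; _×_; _,_)
open import Data.Sum using (_⊎_)
open import Relation.Nullary using (¬_; does)
open import Relation.Binary.PropositionalEquality using (_≡_)
open import Function.Bundles using (_⇔_)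

-- Model of the Coxeter group of type D_n as even-signed permutations.
-- An element is written in one-line notation as a list of n signed
-- values (b , k) meaning (-1)^b (k+1), positions/values 0-based.

El : Set
El = List (Bool × ℕ)

-- lookup with a harmless default (never used on genuine elements of W)
lookupD : El → ℕ → Bool × ℕ
lookupD []       k       = false , k
lookupD (x ∷ xs) zero    = x
lookupD (x ∷ xs) (suc k) = lookupD xs k

idEl : ℕ → El
idEl n = map (λ j → false , j) (upTo n)

-- composition (u x)(j) = u(x(j)), with u(-k) = -u(k)
mul : El → El → El
mul u x = map step x
  where
  step : Bool × ℕ → Bool × ℕ
  step (b , k) with lookupD u k
  ... | (c , m) = (b xor c) , m

-- Generators, indexed by Fin n:
--   index i with i + 1 < n  is  s_{i+1}  (swap positions i, i+1),
--   index n-1               is  s'_{n-1} (swap positions n-2, n-1 and negate both).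
gen : (n : ℕ) → Fin n → El
gen n i = map f (upTo n)
  where
  i' = toℕ i
  f : ℕ → Bool × ℕ
  f j = if does (suc i' <? n)
        then (if does (j ≟ i') then (false , suc j)
              else if does (j ≟ suc i') then (false , i')
              else (false , j))
        else (if does (j + 2 ≟ n) then (true , suc j)
              else if does (j + 1 ≟ n) then (true , j ∸ 1)
              else (false , j))

prod : (n : ℕ) → List (Fin n) → El
prod n ws = foldl (λ acc s → mul acc (gen n s)) (idEl n) ws

InW : (n : ℕ) → El → Set
InW n u = ∃ λ (ws : List (Fin n)) → prod n ws ≡ u

IsLength : (n : ℕ) → El → ℕ → Set
IsLength n u k =
  (∃ λ (ws : List (Fin n)) → prod n ws ≡ u × length ws ≡ k) ×
  (∀ (ws : List (Fin n)) → prod n ws ≡ u → k ≤ length ws)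

-- right weak order: u ≤ w iff ℓ(w) = ℓ(u) + ℓ(u⁻¹w); here x = u⁻¹w
WLe : (n : ℕ) → El → El → Set
WLe n u w = ∃ λ x → InW n x × mul u x ≡ w ×
  (∃ λ a → ∃ λ b → ∃ λ c → IsLength n u a × IsLength n x b × IsLength n w c × c ≡ a + b)

Des : (n : ℕ) → El → Fin n → Set
Des n v s = ∃ λ a → ∃ λ b → IsLength n (mul v (gen n s)) a × IsLength n v b × a < b

BooleanInterval : (n : ℕ) → El → El → Set
BooleanInterval n v w = ∃ λ (m : ℕ) → ∃ λ (f : Subset m → El) →
  (∀ A → WLe n v (f A) × WLe n (f A) w) ×
  (∀ u → WLe n v u → WLe n u w → ∃ λ A → f A ≡ u) ×
  (∀ A B → (A ⊆ B) ⇔ WLe n (f A) (f B))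

Edge : (n : ℕ) → Fin n → Fin n → Set
Edge n i j = (suc (toℕ i) ≡ toℕ j × suc (toℕ j) < n)      -- s_{i+1} — s_{i+2}
           ⊎ (toℕ i + 3 ≡ n × toℕ j + 1 ≡ n)               -- s_{n-2} — s'_{n-1}

Adj : (n : ℕ) → Fin n → Fin n → Set
Adj n i j = Edge n i j ⊎ Edge n j i

module Induced (n : ℕ) (T : Fin n → Set) where

  data Conn : Fin n → Fin n → Set where
    here : ∀ {x} → T x → Conn x x
    step : ∀ {x y z} → T x → Adj n x y → Conn y z → Conn x z

  IsComponent : List (Fin n) → Set
  IsComponent C =
    Unique C ×
    (∃ λ x → x ∈ C) ×
    (∀ x → x ∈ C → T x) ×
    (∀ x y → x ∈ C → y ∈ C → Conn x y) ×
    (∀ x y → x ∈ C → T y → Adj n x y → y ∈ C)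

  Deg3 : Fin n → Set
  Deg3 x = T x × ∃ λ (L : List (Fin n)) → Unique L × length L ≡ 3 ×
           (∀ y → (y ∈ L) ⇔ (T y × Adj n x y))

  Disjoint : List (Fin n) → List (Fin n) → Set
  Disjoint A B = ∀ x → x ∈ A → x ∈ B → Data.Empty.⊥
    where import Data.Empty

  IsB0 : List (Fin n) → Set
  IsB0 b0 = (∃ λ x → Deg3 x × x ∈ b0 × IsComponent b0)
          ⊎ ((¬ ∃ λ x → Deg3 x) × b0 ≡ [])

  IsRest : List (Fin n) → List (List (Fin n)) → Set
  IsRest b0 bs =
    All IsComponent bs ×
    AllPairs Disjoint bs ×
    All (Disjoint b0) bs ×
    (∀ x → T x → x ∈ b0 ⊎ Any (x ∈_) bs)

dseq : ℕ → ℕ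
dseq 0 = 1
dseq 1 = 1
dseq 2 = 4
dseq (suc (suc (suc m))) = dseq (suc (suc m)) + dseq (suc m)

fib : ℕ → ℕ
fib 0 = 0
fib 1 = 1
fib (suc (suc m)) = fib (suc m) + fib m

NonDes : (n : ℕ) → El → Fin n → Set
NonDes n v s = ¬ Des n v s

{-# OPTIONS --safe #-}
module Submission where

-- Generators act on signed indices, and s is an ascent of u iff u maps the simple root of s to a
-- positive root; this gives the exchange condition and shows that for pairwise commuting ascents J
-- of v every product of v with a subset of J has the expected length, so that [v , v·∏J] is Boolean.
-- Conversely, in a Boolean interval let s_i label the cover of v corresponding to the atom i.  If
-- b t = a u with a ≠ b and b ≠ t, then t = a, u = b and a, b commute; going up the squares of the
-- Boolean lattice this forces the element over a set K of atoms to be v·∏_{i∈K} s_i.  So the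
-- intervals correspond to the independent sets of the graph induced on the ascents.  Their number
-- is multiplicative over components, and adding a pendant vertex gives the recursion
-- c(k) = c(k-1) + c(k-2) for a path (Fibonacci) as well as for a tree forking at its end (d).

open import Defs
open import Data.Nat.Properties
open import Algebra.Properties.CommutativeSemigroup +-commutativeSemigroup using (interchange)
open import Data.Bool using (Bool; true; false; if_then_else_; _xor_; not; _∧_)
open import Data.Bool.Properties using (not-involutive; not-injective; ¬-not; ∧-comm; ∧-assoc; ∧-identityʳ)
import Data.Bool.Properties as Bool
open import Data.Empty using (⊥; ⊥-elim)
open import Data.Fin using (Fin; toℕ; fromℕ<; zero; suc)
import Data.Fin.Properties as Fin
open import Data.Fin.Subset using (Subset; inside; outside; ⁅_⁆; _∪_) renaming (_⊆_ to _⊆ˢ_; _∈_ to _∈ˢ_; _∉_ to _∉ˢ_; ⊤ to ⊤ˢ; ⊥ to ⊥ˢ)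
import Data.Fin.Subset.Properties as Subset
open import Data.List using (List; []; _∷_; [_]; _++_; map; upTo; applyUpTo; foldl; length; initLast; _∷ʳ′_; lookup; filter; allFin; concat)
open import Data.List.Properties using (map-cong; map-∘; map-upTo; length-++; length-map; length-tabulate; ++-assoc; ++-identityʳ; ∷-injectiveʳ)
open import Data.List.Membership.DecPropositional using (_∈?_)
open import Data.List.Membership.Propositional using (_∈_; _∉_)
open import Data.List.Membership.Propositional.Properties using (∈-∃++; ∈-++⁺ˡ; ∈-++⁺ʳ; ∈-++⁻; ∈-lookup; ∈-allFin; ∈-filter⁻; ∈-filter⁺; ∈-map⁺; ∈-map⁻; ∈-concat⁺; ∈-concat⁻′)
open import Data.List.Relation.Binary.Permutation.Propositional using (_↭_; prep; swap; refl; ↭-sym; ↭-trans; ↭-refl; ↭⇒↭ₛ)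
open import Data.List.Relation.Binary.Permutation.Propositional.Properties using (shift; ∈-resp-↭; All-resp-↭; ↭-length; ∷↭∷ʳ; ++⁺ʳ; drop-∷)
import Data.List.Relation.Binary.Permutation.Setoid.Properties as ↭ₛ
open import Data.List.Relation.Binary.Sublist.Propositional as Sublist using ([]; _∷_; _∷ʳ_) renaming (_⊆_ to _⊑_)
open import Data.List.Relation.Binary.Sublist.Propositional.Properties using (All-resp-⊆; filter-⊆)
open import Data.List.Relation.Binary.Subset.Propositional using (_⊆_)
open import Data.List.Relation.Unary.All as All using (All; []; _∷_)
import Data.List.Relation.Unary.All.Properties as All
open import Data.List.Relation.Unary.AllPairs as AllPairs using (AllPairs; []; _∷_)
import Data.List.Relation.Unary.AllPairs.Properties as AllPairs
open import Data.List.Relation.Unary.Any using (here; there)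
open import Data.List.Relation.Unary.Unique.Propositional using (Unique)
import Data.List.Relation.Unary.Unique.Propositional.Properties as Unique
open import Data.Nat
open import Data.Nat.ListAction using (product)
open import Data.Product using (∃; ∃₂; _×_; _,_; proj₁; proj₂)
open import Data.Product.Properties using (≡-dec)
open import Data.Sum as Sum using (_⊎_; inj₁; inj₂)
import Data.Vec as Vec
open import Function using (_∘_; id)
open import Function.Bundles using (_⇔_; mk⇔; Equivalence)
open import Relation.Binary.Definitions using (Decidable; DecidableEquality; Symmetric; tri<; tri≈; tri>)
open import Relation.Binary.PropositionalEquality as ≡ using (_≡_; _≢_; refl; sym; trans; cong; cong₂; subst; subst₂; resp₂)
open import Relation.Nullary using (¬_; Dec; yes; no; does)
open import Relation.Nullary.Decidable using (dec-true; dec-false; map′; _⊎-dec_)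

-- Signed permutations

-- A Boolean interval supplies only an order isomorphism from subsets, with no generators attached.
-- They appear because adding one atom must multiply by a single generator: an intermediate element
-- would be the image of an intermediate subset, and there is none. The relation b t = a u compares
-- the two ways up to a common cover once their common prefix is cancelled. It is settled by
-- following one root, which treats all pairs of generators alike.
--
-- The unusual value d_2 = 4 is the count for the two commuting end generators, which are not
-- adjacent and so form no component. With d_1 = 1, the single choice left for them once the vertex
-- below both is taken, it gives d_3 = 5. Since also F_5 = 5, a fork with three vertices, which is a
-- path, may be counted either way. This reconciles two different splittings of the components: by
-- the presence of a vertex of degree three, as in the theorem, and by the presence of both end
-- generators, as in the recursion.

Signed : Set
Signed = Bool × ℕ

neg : Signed → Signed
neg (b , k) = not b , k

xor-cancel : ∀ b c → (b xor c) xor c ≡ b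
xor-cancel false false = refl
xor-cancel false true  = refl
xor-cancel true  false = refl
xor-cancel true  true  = refl

-- Both kinds of generators at once: `ε` tells whether the two exchanged values also change sign.
-- The map `swap±` itself stays opaque and is analysed only through this graph.
data SwapView (ε : Bool) (p : ℕ) : Signed → Signed → Set where
  lower : ∀ b → SwapView ε p (b , p) (b xor ε , suc p)
  upper : ∀ b → SwapView ε p (b , suc p) (b xor ε , p)
  fixed : ∀ {b k} → k ≢ p → k ≢ suc p → SwapView ε p (b , k) (b , k)

abstract
  swap± : Bool → ℕ → Signed → Signed
  swap± ε p (b , k) =
    if does (k ≟ p) then (b xor ε , suc p)
    else if does (k ≟ suc p) then (b xor ε , p)
    else (b , k)

  swapView : ∀ ε p z → SwapView ε p z (swap± ε p z)
  swapView ε p (b , k) with k ≟ p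
  ... | yes refl rewrite dec-true (p ≟ p) refl = lower b
  ... | no k≢p with k ≟ suc p
  ...   | yes refl rewrite dec-false (suc p ≟ p) k≢p | dec-true (p ≟ p) refl = upper b
  ...   | no k≢1+p rewrite dec-false (k ≟ p) k≢p | dec-false (k ≟ suc p) k≢1+p = fixed k≢p k≢1+p

swapView-unique : ∀ {ε p z z₁ z₂} → SwapView ε p z z₁ → SwapView ε p z z₂ → z₁ ≡ z₂
swapView-unique (lower b) (lower .b) = refl
swapView-unique (lower b) (fixed k≢p _) = ⊥-elim (k≢p refl)
swapView-unique (upper b) (upper .b) = refl
swapView-unique (upper b) (fixed _ k≢) = ⊥-elim (k≢ refl)
swapView-unique (fixed k≢p _) (lower _) = ⊥-elim (k≢p refl)
swapView-unique (fixed _ k≢) (upper _) = ⊥-elim (k≢ refl)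
swapView-unique (fixed _ _) (fixed _ _) = refl

swap±-≡ : ∀ {ε p z z′} → SwapView ε p z z′ → swap± ε p z ≡ z′
swap±-≡ {ε} {p} {z} v = swapView-unique (swapView ε p z) v

swap±-involutive : ∀ ε p z → swap± ε p (swap± ε p z) ≡ z
swap±-involutive ε p z with swap± ε p z | swapView ε p z
... | _ | lower b = trans (swap±-≡ (upper _)) (cong (_, p) (xor-cancel b ε))
... | _ | upper b = trans (swap±-≡ (lower _)) (cong (_, suc p) (xor-cancel b ε))
... | _ | fixed k≢p k≢ = swap±-≡ (fixed k≢p k≢)

not-xor : ∀ b c → not b xor c ≡ not (b xor c)
not-xor false c = refl
not-xor true  c = sym (not-involutive c)

swap±-neg : ∀ ε p z → swap± ε p (neg z) ≡ neg (swap± ε p z)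
swap±-neg ε p z with swap± ε p z | swapView ε p z
... | _ | lower b = trans (swap±-≡ (lower _)) (cong (_, suc p) (not-xor b ε))
... | _ | upper b = trans (swap±-≡ (upper _)) (cong (_, p) (not-xor b ε))
... | _ | fixed k≢p k≢ = swap±-≡ (fixed k≢p k≢)

act : El → Signed → Signed
act u (b , k) = b xor proj₁ (lookupD u k) , proj₂ (lookupD u k)

mul-act : ∀ u x → mul u x ≡ map (act u) x
mul-act u [] = refl
mul-act u ((b , k) ∷ x) = cong₂ _∷_ refl (mul-act u x)

lookupD-applyUpTo : ∀ (f : ℕ → Signed) n {k} → k < n → lookupD (applyUpTo f n) k ≡ f k
lookupD-applyUpTo f (suc n) {zero} _ = refl
lookupD-applyUpTo f (suc n) {suc k} (s≤s k<n) = lookupD-applyUpTo (f ∘ suc) n k<n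

map-cong-upTo : ∀ {A : Set} {f g : ℕ → A} n → (∀ k → k < n → f k ≡ g k) → map f (upTo n) ≡ map g (upTo n)
map-cong-upTo {f = f} {g} n eq = trans (map-upTo f n) (trans (go f g n eq) (sym (map-upTo g n)))
  where
  go : ∀ {A : Set} (f g : ℕ → A) n → (∀ k → k < n → f k ≡ g k) → applyUpTo f n ≡ applyUpTo g n
  go f g zero eq = refl
  go f g (suc n) eq = cong₂ _∷_ (eq 0 z<s) (go (f ∘ suc) (g ∘ suc) n (λ k k<n → eq (suc k) (s<s k<n)))

toEl : ℕ → (Signed → Signed) → El
toEl n g = map (λ k → g (false , k)) (upTo n)

lookupD-toEl : ∀ n g {k} → k < n → lookupD (toEl n g) k ≡ g (false , k)
lookupD-toEl n g {k} k<n =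
  trans (cong (λ u → lookupD u k) (map-upTo (λ k → g (false , k)) n)) (lookupD-applyUpTo _ n k<n)

Odd : (Signed → Signed) → Set
Odd g = ∀ z → g (neg z) ≡ neg (g z)

odd-xor : ∀ {g} → Odd g → ∀ b k → g (b , k) ≡ (b xor proj₁ (g (false , k)) , proj₂ (g (false , k)))
odd-xor odd false k = refl
odd-xor odd true  k = odd (false , k)

act-toEl : ∀ n {g} → Odd g → ∀ z → proj₂ z < n → act (toEl n g) z ≡ g z
act-toEl n {g} odd (b , k) k<n rewrite lookupD-toEl n g k<n = sym (odd-xor odd b k)

mul-toEl : ∀ n {g} h → Odd g → (∀ k → k < n → proj₂ (h (false , k)) < n) →
  mul (toEl n g) (toEl n h) ≡ toEl n (g ∘ h)
mul-toEl n {g} h odd bounded = trans (mul-act (toEl n g) (toEl n h))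
  (trans (sym (map-∘ (upTo n))) (map-cong-upTo n λ k k<n → act-toEl n odd (h (false , k)) (bounded k k<n)))

-- Words in the generators and their action on signed indices

module Words (m : ℕ) where

  n : ℕ
  n = suc (suc m)

  V : Set
  V = Fin n

  Word : Set
  Word = List V

  data GenView (i : V) : Bool → ℕ → Set where
    plain   : toℕ i ≤ m → GenView i false (toℕ i)
    twisted : toℕ i ≡ suc m → GenView i true m

  abstract
    -- The twins s_{n-1} and s'_{n-1} share the level m; adjacency in the Coxeter graph is being at consecutive levels.
    twist : V → Bool
    twist i = not (does (suc (toℕ i) <? n))

    level : V → ℕ
    level i = if does (suc (toℕ i) <? n) then toℕ i else m

    genView : ∀ i → GenView i (twist i) (level i)
    genView i with suc (toℕ i) <? n
    ... | yes p rewrite dec-true (suc (toℕ i) <? n) p = plain (s≤s⁻¹ (s≤s⁻¹ p))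
    ... | no ¬p rewrite dec-false (suc (toℕ i) <? n) ¬p =
      twisted (≤-antisym (s≤s⁻¹ (Fin.toℕ<n i)) (s≤s⁻¹ (≮⇒≥ ¬p)))

  σ : V → Signed → Signed
  σ i = swap± (twist i) (level i)

  actW : Word → Signed → Signed
  actW [] z = z
  actW (s ∷ ws) z = σ s (actW ws z)

  -- A copy of the local function of `gen`, which cannot be named from outside. It agrees with it
  -- definitionally, so `gen-σ` is a mere `map-cong`.
  genAt : V → ℕ → Signed
  genAt i j = if does (suc (toℕ i) <? n)
        then (if does (j ≟ toℕ i) then (false , suc j)
              else if does (j ≟ suc (toℕ i)) then (false , toℕ i)
              else (false , j))
        else (if does (j + 2 ≟ n) then (true , suc j)
              else if does (j + 1 ≟ n) then (true , j ∸ 1)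
              else (false , j))

  genAt-σ : ∀ i k → genAt i k ≡ σ i (false , k)
  genAt-σ i k with twist i | level i | genView i
  ... | _ | _ | plain i≤m
    rewrite dec-true (suc (toℕ i) <? n) (s≤s (s≤s i≤m))
    with swap± false (toℕ i) (false , k) | swapView false (toℕ i) (false , k)
  ...   | _ | lower _ rewrite dec-true (toℕ i ≟ toℕ i) refl = refl
  ...   | _ | upper _
    rewrite dec-false (suc (toℕ i) ≟ toℕ i) 1+n≢n | dec-true (toℕ i ≟ toℕ i) refl = refl
  ...   | _ | fixed k≢i k≢1+i
    rewrite dec-false (k ≟ toℕ i) k≢i | dec-false (k ≟ suc (toℕ i)) k≢1+i = refl
  genAt-σ i k | _ | _ | twisted i≡1+m
    rewrite dec-false (suc (toℕ i) <? n) (λ lt → <-irrefl (cong suc i≡1+m) lt)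
    with swap± true m (false , k) | swapView true m (false , k)
  ...   | _ | lower _ rewrite dec-true (m + 2 ≟ n) (+-comm m 2) = refl
  ...   | _ | upper _
    rewrite dec-false (suc m + 2 ≟ n) (λ eq → 1+n≢n (trans (sym (+-comm (suc m) 2)) eq))
          | dec-true (suc m + 1 ≟ n) (+-comm (suc m) 1) = refl
  ...   | _ | fixed k≢m k≢1+m
    rewrite dec-false (k + 2 ≟ n) (λ eq → k≢m (suc-injective (suc-injective (trans (+-comm 2 k) eq))))
          | dec-false (k + 1 ≟ n) (λ eq → k≢1+m (suc-injective (trans (+-comm 1 k) eq))) = refl

  gen-σ : ∀ i → gen n i ≡ toEl n (σ i)
  gen-σ i = map-cong (genAt-σ i) (upTo n)

  level≤m : ∀ i → level i ≤ m
  level≤m i with twist i | level i | genView i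
  ... | _ | _ | plain i≤m = i≤m
  ... | _ | _ | twisted _ = ≤-refl

  twist-true⇒level≡m : ∀ i → twist i ≡ true → level i ≡ m
  twist-true⇒level≡m i eq with twist i | level i | genView i
  ... | _ | _ | twisted _ = refl

  twist-level-injective : ∀ {i j} → twist i ≡ twist j → level i ≡ level j → i ≡ j
  twist-level-injective {i} {j} t≡ l≡ with twist i | level i | genView i | twist j | level j | genView j
  ... | _ | _ | plain _ | _ | _ | plain _ = Fin.toℕ-injective l≡
  ... | _ | _ | twisted p | _ | _ | twisted q = Fin.toℕ-injective (trans p (sym q))

  σ-involutive : ∀ i z → σ i (σ i z) ≡ z
  σ-involutive i = swap±-involutive (twist i) (level i)

  σ-injective : ∀ i {y z} → σ i y ≡ σ i z → y ≡ z
  σ-injective i {y} {z} eq = trans (sym (σ-involutive i y)) (trans (cong (σ i) eq) (σ-involutive i z))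

  σ-bounded : ∀ i z → proj₂ z < n → proj₂ (σ i z) < n
  σ-bounded i z z<n with swap± (twist i) (level i) z | swapView (twist i) (level i) z
  ... | _ | lower _ = s≤s (s≤s (level≤m i))
  ... | _ | upper _ = s≤s (m≤n⇒m≤1+n (level≤m i))
  ... | _ | fixed _ _ = z<n

  σ-fixes : ∀ i z → n ≤ proj₂ z → σ i z ≡ z
  σ-fixes i z n≤z with swap± (twist i) (level i) z | swapView (twist i) (level i) z
  ... | _ | lower _ = ⊥-elim (<⇒≱ (s≤s (m≤n⇒m≤1+n (level≤m i))) n≤z)
  ... | _ | upper _ = ⊥-elim (<⇒≱ (s≤s (s≤s (level≤m i))) n≤z)
  ... | _ | fixed _ _ = refl

  actW-++ : ∀ us ws z → actW (us ++ ws) z ≡ actW us (actW ws z)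
  actW-++ [] ws z = refl
  actW-++ (s ∷ us) ws z = cong (σ s) (actW-++ us ws z)

  actW-neg : ∀ ws → Odd (actW ws)
  actW-neg [] z = refl
  actW-neg (s ∷ ws) z = trans (cong (σ s) (actW-neg ws z)) (swap±-neg (twist s) (level s) (actW ws z))

  actW-injective : ∀ ws {y z} → actW ws y ≡ actW ws z → y ≡ z
  actW-injective [] eq = eq
  actW-injective (s ∷ ws) eq = actW-injective ws (σ-injective s eq)

  actW-bounded : ∀ ws z → proj₂ z < n → proj₂ (actW ws z) < n
  actW-bounded [] z z<n = z<n
  actW-bounded (s ∷ ws) z z<n = σ-bounded s _ (actW-bounded ws z z<n)

  actW-fixes : ∀ ws z → n ≤ proj₂ z → actW ws z ≡ z
  actW-fixes [] z _ = refl
  actW-fixes (s ∷ ws) z n≤z = trans (cong (σ s) (actW-fixes ws z n≤z)) (σ-fixes s z n≤z)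

  -- Since `prod` folds from the left, the induction has to start from an arbitrary accumulator,
  -- which is itself written as a word `us`.
  prod-toEl : ∀ ws → prod n ws ≡ toEl n (actW ws)
  prod-toEl = go []
    where
    go : ∀ us ws → foldl (λ acc s → mul acc (gen n s)) (toEl n (actW us)) ws ≡ toEl n (actW (us ++ ws))
    go us [] = map-cong (λ k → sym (actW-++ us [] (false , k))) (upTo n)
    go us (s ∷ ws) = trans
      (cong (λ u → foldl (λ acc s → mul acc (gen n s)) u ws)
        (trans (cong (mul (toEl n (actW us))) (gen-σ s))
          (trans (mul-toEl n (σ s) (actW-neg us) (λ k k<n → σ-bounded s (false , k) k<n))
            (map-cong (λ k → sym (actW-++ us (s ∷ []) (false , k))) (upTo n)))))
      (trans (go (us ++ s ∷ []) ws) (cong (λ w → toEl n (actW w)) (++-assoc us (s ∷ []) ws)))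

  infix 4 _≋_
  record _≋_ (us ws : Word) : Set where
    constructor pointwise
    field at : ∀ z → actW us z ≡ actW ws z
  open _≋_ public

  ≋-refl : ∀ {us} → us ≋ us
  ≋-refl .at z = refl

  ≋-sym : ∀ {us ws} → us ≋ ws → ws ≋ us
  ≋-sym eq .at z = sym (at eq z)

  ≋-trans : ∀ {us vs ws} → us ≋ vs → vs ≋ ws → us ≋ ws
  ≋-trans eq eq′ .at z = trans (at eq z) (at eq′ z)

  ≡⇒≋ : ∀ {us ws} → us ≡ ws → us ≋ ws
  ≡⇒≋ refl = ≋-refl

  ++-cong : ∀ {us us′ ws ws′} → us ≋ us′ → ws ≋ ws′ → us ++ ws ≋ us′ ++ ws′
  ++-cong {us} {us′} {ws} {ws′} eq eq′ .at z = trans (actW-++ us ws z)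
    (trans (cong (actW us) (at eq′ z)) (trans (at eq _) (sym (actW-++ us′ ws′ z))))

  ++-congˡ : ∀ us {ws ws′} → ws ≋ ws′ → us ++ ws ≋ us ++ ws′
  ++-congˡ us eq = ++-cong (≋-refl {us}) eq

  ++-congʳ : ∀ {us us′} ws → us ≋ us′ → us ++ ws ≋ us′ ++ ws
  ++-congʳ ws eq = ++-cong eq (≋-refl {ws})

  ++-cancelˡ-≋ : ∀ us {ws ws′} → us ++ ws ≋ us ++ ws′ → ws ≋ ws′
  ++-cancelˡ-≋ us {ws} {ws′} eq .at z = actW-injective us
    (trans (sym (actW-++ us ws z)) (trans (at eq z) (actW-++ us ws′ z)))

  cancel-last : ∀ us t → (us ++ [ t ]) ++ [ t ] ≋ us
  cancel-last us t .at z = trans (actW-++ (us ++ [ t ]) [ t ] z)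
    (trans (actW-++ us [ t ] (σ t z)) (cong (actW us) (σ-involutive t z)))

  -- prod, made abstract because unification would otherwise unfold the fold.
  abstract
    el : Word → El
    el ws = prod n ws

    el≡prod : ∀ ws → el ws ≡ prod n ws
    el≡prod ws = refl

  el-toEl : ∀ ws → el ws ≡ toEl n (actW ws)
  el-toEl ws = trans (el≡prod ws) (prod-toEl ws)

  ≋⇒el≡ : ∀ {us ws} → us ≋ ws → el us ≡ el ws
  ≋⇒el≡ {us} {ws} eq = trans (el-toEl us)
    (trans (map-cong (λ k → at eq (false , k)) (upTo n)) (sym (el-toEl ws)))

  -- The list records only the images of the positive indices below `n`. Oddness gives those of the
  -- negative ones, and every word fixes the indices from `n` on.
  el≡⇒≋ : ∀ {us ws} → el us ≡ el ws → us ≋ ws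
  el≡⇒≋ {us} {ws} eq .at (b , k) with k <? n
  ... | no k≮n = trans (actW-fixes us _ (≮⇒≥ k≮n)) (sym (actW-fixes ws _ (≮⇒≥ k≮n)))
  ... | yes k<n = trans (odd-xor (actW-neg us) b k)
    (trans (cong (λ y → b xor proj₁ y , proj₂ y) eq₀) (sym (odd-xor (actW-neg ws) b k)))
    where
    eq₀ : actW us (false , k) ≡ actW ws (false , k)
    eq₀ = trans (sym (lookupD-toEl n (actW us) k<n))
      (trans (cong (λ u → lookupD u k) (trans (sym (el-toEl us)) (trans eq (el-toEl ws))))
        (lookupD-toEl n (actW ws) k<n))

  mul-el : ∀ us ws → mul (el us) (el ws) ≡ el (us ++ ws)
  mul-el us ws = trans (cong₂ mul (el-toEl us) (el-toEl ws))
    (trans (mul-toEl n (actW ws) (actW-neg us) (λ k k<n → actW-bounded ws (false , k) k<n))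
      (trans (map-cong (λ k → sym (actW-++ us ws (false , k))) (upTo n)) (sym (el-toEl (us ++ ws)))))

-- Roots and the exchange condition

_≟±_ : DecidableEquality Signed
_≟±_ = ≡-dec Bool._≟_ _≟_

-- τ is the reflection in the root e_x + e_y, where e_{neg x} = - e_x.
record IsReflection (x y : Signed) (τ : Signed → Signed) : Set where
  field
    odd    : Odd τ
    first  : τ x ≡ neg y
    second : τ y ≡ neg x
    fixes  : ∀ {z} → z ≢ x → z ≢ neg x → z ≢ y → z ≢ neg y → τ z ≡ z

reflection-sym : ∀ {x y τ} → IsReflection x y τ → IsReflection y x τ
reflection-sym r = record
  { odd = odd ; first = second ; second = first ; fixes = λ a b c d → fixes c d a b }
  where open IsReflection r

-- A reflection is determined by its root, so a map carrying one root to the other conjugates the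
-- reflections. The two sides are compared at the four indices plus or minus `x` and `y`, and at all
-- others, which are fixed.
reflection-conj : ∀ {g σ τ x y} → Odd g → (∀ {y z} → g y ≡ g z → y ≡ z) →
  IsReflection x y σ → IsReflection (g x) (g y) τ → ∀ z → g (σ z) ≡ τ (g z)
reflection-conj {g} {σ} {τ} {x} {y} odd-g inj S T z = go (z ≟± x) (z ≟± neg x) (z ≟± y) (z ≟± neg y)
  where
  module S = IsReflection S
  module T = IsReflection T
  at : ∀ {x y} → σ x ≡ neg y → τ (g x) ≡ neg (g y) → g (σ x) ≡ τ (g x)
  at p q = trans (cong g p) (trans (odd-g _) (sym q))
  at-neg : ∀ {x y} → σ x ≡ neg y → τ (g x) ≡ neg (g y) → g (σ (neg x)) ≡ τ (g (neg x))
  at-neg {x} {y} p q = trans (cong g (S.odd x)) (trans (odd-g _)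
    (trans (cong neg (at p q)) (sym (trans (cong τ (odd-g x)) (T.odd (g x))))))
  avoid : ∀ {w} → z ≢ neg w → g z ≢ neg (g w)
  avoid z≢ eq = z≢ (inj (trans eq (sym (odd-g _))))
  go : Dec (z ≡ x) → Dec (z ≡ neg x) → Dec (z ≡ y) → Dec (z ≡ neg y) → g (σ z) ≡ τ (g z)
  go (yes refl) _ _ _ = at S.first T.first
  go _ (yes refl) _ _ = at-neg S.first T.first
  go _ _ (yes refl) _ = at S.second T.second
  go _ _ _ (yes refl) = at-neg S.second T.second
  go (no a) (no b) (no c) (no d) = trans (cong g (S.fixes a b c d))
    (sym (T.fixes (λ eq → a (inj eq)) (avoid b) (λ eq → c (inj eq)) (avoid d)))

abstract
  -- Sign of the root e_x + e_y: the coordinate with the smaller index decides, so the positive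
  -- roots are e_k - e_l and e_k + e_l with k < l.
  positive : Signed → Signed → Bool
  positive (b , k) (c , l) = not (if does (k <? l) then b else c)

  positive-< : ∀ {b c k l} → k < l → positive (b , k) (c , l) ≡ not b
  positive-< {k = k} {l} k<l rewrite dec-true (k <? l) k<l = refl

  positive-> : ∀ {b c k l} → l < k → positive (b , k) (c , l) ≡ not c
  positive-> {k = k} {l} l<k rewrite dec-false (k <? l) (<-asym l<k) = refl

  positive-neg : ∀ x y → positive (neg x) (neg y) ≡ not (positive x y)
  positive-neg (b , k) (c , l) with does (k <? l)
  ... | true = refl
  ... | false = refl

positive-sym : ∀ x y → proj₂ x ≢ proj₂ y → positive x y ≡ positive y x
positive-sym (b , k) (c , l) k≢l with <-cmp k l
... | tri< k<l _ _ = trans (positive-< {b} {c} k<l) (sym (positive-> {c} {b} k<l))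
... | tri≈ _ k≡l _ = ⊥-elim (k≢l k≡l)
... | tri> _ _ l<k = trans (positive-> {b} {c} l<k) (sym (positive-< {c} {b} l<k))

true≢false : true ≢ false
true≢false ()

module Roots (m : ℕ) where
  open Words m public

  -- The simple root of s is e_{α₁ s} + e_{α₂ s}.
  α₁ α₂ : V → Signed
  α₁ s = false , level s
  α₂ s = not (twist s) , suc (level s)

  σ-reflection : ∀ s → IsReflection (α₁ s) (α₂ s) (σ s)
  σ-reflection s = record
    { odd = λ z → swap±-neg (twist s) (level s) z
    ; first = trans (swap±-≡ {twist s} (lower false)) (cong (_, suc (level s)) (sym (not-involutive (twist s))))
    ; second = trans (swap±-≡ {twist s} (upper (not (twist s)))) (cong (_, level s) (not-xor-same (twist s)))
    ; fixes = λ {z} → fix z }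
    where
    not-xor-same : ∀ b → not b xor b ≡ true
    not-xor-same false = refl
    not-xor-same true = refl
    fix : ∀ z → z ≢ α₁ s → z ≢ neg (α₁ s) → z ≢ α₂ s → z ≢ neg (α₂ s) → σ s z ≡ z
    fix z a b c d with swap± (twist s) (level s) z | swapView (twist s) (level s) z
    ... | _ | lower false = ⊥-elim (a refl)
    ... | _ | lower true  = ⊥-elim (b refl)
    ... | _ | upper e with e Bool.≟ not (twist s)
    ...   | yes refl = ⊥-elim (c refl)
    ...   | no e≢ = ⊥-elim (d (cong (_, suc (level s)) (¬-not e≢)))
    fix z a b c d | _ | fixed _ _ = refl

  IsSimple : V → Signed → Signed → Set
  IsSimple s x y = (x ≡ α₁ s × y ≡ α₂ s) ⊎ (x ≡ α₂ s × y ≡ α₁ s)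

  -- The sign at the smaller index decides. Unless the two indices are the exchanged ones, it can
  -- change only if the generator is twisted and moves the smaller index. But a twisted generator
  -- exchanges the last two indices below `n`, which leaves no room for a larger index that it
  -- fixes.
  ordered-flip : ∀ s b k c l → k < l → l < n → positive (b , k) (c , l) ≡ true →
    positive (σ s (b , k)) (σ s (c , l)) ≡ false → (b , k) ≡ α₁ s × (c , l) ≡ α₂ s
  ordered-flip s true k c l k<l l<n pos _ =
    ⊥-elim (true≢false (trans (sym pos) (positive-< {true} {c} k<l)))
  ordered-flip s false k c l k<l l<n pos flip
    with swap± (twist s) (level s) (false , k) | swapView (twist s) (level s) (false , k)
       | swap± (twist s) (level s) (c , l) | swapView (twist s) (level s) (c , l)
  ... | _ | lower _ | _ | lower _ = ⊥-elim (<-irrefl refl k<l)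
  ... | _ | lower _ | _ | upper _ = refl , cong (_, suc (level s)) (xor-true c (twist s) eq)
    where
    xor-true : ∀ b c → b xor c ≡ true → b ≡ not c
    xor-true false true _ = refl
    xor-true true false _ = refl
    eq : c xor twist s ≡ true
    eq = not-injective (trans (sym (positive-> {twist s} {c xor twist s} (n<1+n (level s)))) flip)
  ... | _ | lower _ | _ | fixed l≢p l≢1+p = ⊥-elim (<⇒≱ l<n
        (subst (λ p → suc (suc p) ≤ l) (twist-true⇒level≡m s twisted′) 1+p<l))
    where
    1+p<l : suc (level s) < l
    1+p<l = ≤∧≢⇒< k<l (l≢1+p ∘ sym)
    twisted′ : twist s ≡ true
    twisted′ = not-injective (trans (sym (positive-< {twist s} {c} 1+p<l)) flip)
  ... | _ | upper _ | _ | lower _ = ⊥-elim (<-asym k<l (n<1+n (level s)))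
  ... | _ | upper _ | _ | upper _ = ⊥-elim (<-irrefl refl k<l)
  ... | _ | upper _ | _ | fixed l≢p l≢1+p = ⊥-elim (<⇒≱ l<n
        (subst (λ p → suc (suc p) ≤ l) (twist-true⇒level≡m s twisted′) k<l))
    where
    twisted′ : twist s ≡ true
    twisted′ = not-injective (trans (sym (positive-< {twist s} {c} (<-trans (n<1+n (level s)) k<l))) flip)
  ... | _ | fixed k≢p k≢1+p | _ | lower _ =
    ⊥-elim (true≢false (trans (sym (positive-< {false} {c xor twist s} (m<n⇒m<1+n k<l))) flip))
  ... | _ | fixed k≢p k≢1+p | _ | upper _ =
    ⊥-elim (true≢false (trans (sym (positive-< {false} {c xor twist s} (≤∧≢⇒< (s≤s⁻¹ k<l) k≢p))) flip))
  ... | _ | fixed _ _ | _ | fixed _ _ =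
    ⊥-elim (true≢false (trans (sym (positive-< {false} {c} k<l)) flip))

  index-≢ : ∀ {g} → Odd g → (∀ {y z} → g y ≡ g z → y ≡ z) →
    ∀ x y → proj₂ x ≢ proj₂ y → proj₂ (g x) ≢ proj₂ (g y)
  index-≢ {g} odd inj x y x≢y eq with proj₁ (g x) Bool.≟ proj₁ (g y)
  ... | yes s≡ = x≢y (cong proj₂ (inj (cong₂ _,_ s≡ eq)))
  ... | no s≢ = x≢y (cong proj₂ (inj (trans (cong₂ _,_ (¬-not s≢) eq) (sym (odd y)))))

  σ-flips-only-simple : ∀ s x y → proj₂ x < n → proj₂ y < n → proj₂ x ≢ proj₂ y →
    positive x y ≡ true → positive (σ s x) (σ s y) ≡ false → IsSimple s x y
  σ-flips-only-simple s x y x<n y<n x≢y pos flip with <-cmp (proj₂ x) (proj₂ y)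
  ... | tri≈ _ eq _ = ⊥-elim (x≢y eq)
  ... | tri< x<y _ _ = inj₁ (ordered-flip s _ _ _ _ x<y y<n pos flip)
  ... | tri> _ _ y<x with ordered-flip s _ _ _ _ y<x x<n
    (trans (positive-sym y x (x≢y ∘ sym)) pos)
    (trans (positive-sym (σ s y) (σ s x)
      (index-≢ (IsReflection.odd (σ-reflection s)) (σ-injective s) y x (x≢y ∘ sym))) flip)
  ...   | y≡ , x≡ = inj₂ (x≡ , y≡)

  IsSimple-positive : ∀ {s x y} → IsSimple s x y → positive x y ≡ true
  IsSimple-positive {s} (inj₁ (refl , refl)) = positive-< {false} {not (twist s)} (n<1+n (level s))
  IsSimple-positive {s} (inj₂ (refl , refl)) = positive-> {not (twist s)} {false} (n<1+n (level s))

  ascent : Word → V → Bool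
  ascent ws t = positive (actW ws (α₁ t)) (actW ws (α₂ t))

  MapsTo : Word → V → V → Set
  MapsTo ws t s = IsSimple s (actW ws (α₁ t)) (actW ws (α₂ t))

  conj-σ : ∀ ws t s → MapsTo ws t s → ws ++ [ t ] ≋ s ∷ ws
  conj-σ ws t s h .at z = trans (actW-++ ws [ t ] z)
    (reflection-conj (actW-neg ws) (actW-injective ws) (σ-reflection t) (target h) z)
    where
    target : MapsTo ws t s → IsReflection (actW ws (α₁ t)) (actW ws (α₂ t)) (σ s)
    target (inj₁ (p , q)) rewrite p | q = σ-reflection s
    target (inj₂ (p , q)) rewrite p | q = reflection-sym (σ-reflection s)

  ascent-resp : ∀ {us ws} t → us ≋ ws → ascent us t ≡ ascent ws t
  ascent-resp t eq = cong₂ positive (at eq _) (at eq _)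

  ascent-snoc-same : ∀ ws t → ascent (ws ++ [ t ]) t ≡ not (ascent ws t)
  ascent-snoc-same ws t = trans (cong₂ positive
      (trans (actW-++ ws [ t ] (α₁ t)) (trans (cong (actW ws) first) (actW-neg ws (α₂ t))))
      (trans (actW-++ ws [ t ] (α₂ t)) (trans (cong (actW ws) second) (actW-neg ws (α₁ t)))))
    (trans (positive-neg (actW ws (α₂ t)) (actW ws (α₁ t))) (cong not (positive-sym (actW ws (α₂ t)) (actW ws (α₁ t))
      (index-≢ (actW-neg ws) (actW-injective ws) (α₂ t) (α₁ t) 1+n≢n))))
    where open IsReflection (σ-reflection t)

  ascent-cons : ∀ s ws t → ascent ws t ≡ true → ascent (s ∷ ws) t ≡ false → MapsTo ws t s
  ascent-cons s ws t = σ-flips-only-simple s _ _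
    (actW-bounded ws (α₁ t) (s≤s (m≤n⇒m≤1+n (level≤m t))))
    (actW-bounded ws (α₂ t) (s≤s (s≤s (level≤m t))))
    (index-≢ (actW-neg ws) (actW-injective ws) (α₁ t) (α₂ t) (1+n≢n ∘ sym))

  ascent-[] : ∀ t → ascent [] t ≡ true
  ascent-[] t = IsSimple-positive {t} (inj₁ (refl , refl))

  -- The empty suffix has `t` as an ascent and the whole word does not, so the sign changes when
  -- some letter `s` is prepended to a suffix. That suffix carries the root of `t` to the root of
  -- `s`; hence moving `t` to the left across it turns `t` into a second `s`, which cancels the
  -- first.
  exchange : ∀ ws t → ascent ws t ≡ false → ∃ λ ws′ → length ws ≡ suc (length ws′) × ws ++ [ t ] ≋ ws′
  exchange [] t desc = ⊥-elim (true≢false (trans (sym (ascent-[] t)) desc))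
  exchange (s ∷ ws) t desc with ascent ws t in eq
  ... | false with exchange ws t eq
  ...   | ws′ , len , h = s ∷ ws′ , cong suc len , ++-congˡ [ s ] h
  exchange (s ∷ ws) t desc | true = ws , refl ,
    ≋-trans (++-congˡ [ s ] (conj-σ ws t s (ascent-cons s ws t eq desc))) ss
    where
    ss : s ∷ s ∷ ws ≋ ws
    ss .at z = σ-involutive s (actW ws z)

  Reduced : Word → Set
  Reduced ws = ∀ {us} → us ≋ ws → length ws ≤ length us

  length-snoc : ∀ (ws : Word) t → length (ws ++ [ t ]) ≡ suc (length ws)
  length-snoc ws t = trans (length-++ ws) (+-comm (length ws) 1)

  -- Every word `us` for the product has `t` as a descent, so `exchange` shortens it by one letter
  -- to a word for `r`, which cannot be shorter than `r`.
  reduced-snoc : ∀ {r} t → Reduced r → ascent r t ≡ true → Reduced (r ++ [ t ])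
  reduced-snoc {r} t red asc {us} eq
    with exchange us t (trans (ascent-resp t eq) (trans (ascent-snoc-same r t) (cong not asc)))
  ... | us′ , len , h rewrite length-snoc r t | len =
    s≤s (red (≋-trans (≋-sym h) (≋-trans (++-congʳ [ t ] eq) (cancel-last r t))))

  reduced-descent : ∀ {r} t → Reduced r → ascent r t ≡ false →
    ∃ λ r′ → Reduced r′ × r′ ≋ r ++ [ t ] × length r ≡ suc (length r′)
  reduced-descent {r} t red desc with exchange r t desc
  ... | r′ , len , h = r′ , red′ , ≋-sym h , len
    where
    red′ : Reduced r′
    red′ {us} eq = s≤s⁻¹ (subst₂ _≤_ len (length-snoc us t)
      (red (≋-trans (++-congʳ [ t ] (≋-trans eq (≋-sym h))) (cancel-last r t))))

  reduced-[] : Reduced []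
  reduced-[] _ = z≤n

  -- The letters are appended one at a time to a reduced word: an ascent lengthens it, a descent
  -- replaces it by a shorter reduced word.
  normalise : ∀ ws → ∃ λ r → Reduced r × r ≋ ws
  normalise ws = go ws [] reduced-[]
    where
    go : ∀ ws r → Reduced r → ∃ λ r′ → Reduced r′ × r′ ≋ r ++ ws
    go [] r red = r , red , λ where .at z → sym (actW-++ r [] z)
    go (t ∷ ws) r red with ascent r t in eq
    ... | true with go ws (r ++ [ t ]) (reduced-snoc t red eq)
    ...   | r′ , red′ , h = r′ , red′ , ≋-trans h (≡⇒≋ (++-assoc r [ t ] ws))
    go (t ∷ ws) r red | false with reduced-descent t red eq
    ... | r₁ , red₁ , h₁ , _ with go ws r₁ red₁
    ...   | r′ , red′ , h = r′ , red′ ,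
      ≋-trans h (≋-trans (++-congʳ ws h₁) (≡⇒≋ (++-assoc r [ t ] ws)))

  reduced-resp : ∀ {us ws} → us ≋ ws → length us ≤ length ws → Reduced ws → Reduced us
  reduced-resp eq len red eq′ = ≤-trans len (red (≋-trans eq′ eq))

  reduced-++ˡ : ∀ us ws → Reduced (us ++ ws) → Reduced us
  reduced-++ˡ us ws red {us′} eq = +-cancelʳ-≤ (length ws) (length us) (length us′)
    (subst₂ _≤_ (length-++ us) (length-++ us′) (red (++-congʳ ws eq)))

  reduced-++ʳ : ∀ us ws → Reduced (us ++ ws) → Reduced ws
  reduced-++ʳ us ws red {ws′} eq = +-cancelˡ-≤ (length us) (length ws) (length ws′)
    (subst₂ _≤_ (length-++ us) (length-++ us) (red (++-congˡ us eq)))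

  reduced-snoc⇒ascent : ∀ r t → Reduced (r ++ [ t ]) → ascent r t ≡ true
  reduced-snoc⇒ascent r t red with ascent r t in eq
  ... | true = refl
  ... | false with exchange r t eq
  ...   | r′ , len , h = ⊥-elim (<⇒≱ {length r′} {length (r ++ [ t ])}
    (subst (length r′ <_) (sym (length-snoc r t)) (subst (λ k → length r′ < suc k) (sym len) (m<n⇒m<1+n (n<1+n _))))
    (red (≋-sym h)))

  reduced-length : ∀ {us ws} → us ≋ ws → Reduced us → Reduced ws → length us ≡ length ws
  reduced-length eq red red′ = ≤-antisym (red (≋-sym eq)) (red′ eq)

-- Commuting generators

AllPairs-resp-↭ : ∀ {A : Set} {R : A → A → Set} → Symmetric R → ∀ {xs ys} → xs ↭ ys → AllPairs R xs → AllPairs R ys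
AllPairs-resp-↭ {A} {R} R-sym p = ↭ₛ.AllPairs-resp-↭ (≡.setoid A) R-sym (resp₂ R) (↭⇒↭ₛ p)

module Commutation (m : ℕ) where
  open Roots m public

  infix 4 _—_ _⌿_
  _—_ : V → V → Set
  a — b = suc (level a) ≡ level b ⊎ suc (level b) ≡ level a

  _⌿_ : V → V → Set
  a ⌿ b = a ≢ b × ¬ (a — b)

  ⌿-sym : Symmetric _⌿_
  ⌿-sym (a≢b , a≁b) = a≢b ∘ sym , a≁b ∘ Sum.swap

  MapsTo-∷ : ∀ {x ws t s u} → MapsTo ws t s → MapsTo [ x ] s u → MapsTo (x ∷ ws) t u
  MapsTo-∷ {x} (inj₁ (p , q)) (inj₁ (p′ , q′)) = inj₁ (trans (cong (σ x) p) p′ , trans (cong (σ x) q) q′)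
  MapsTo-∷ {x} (inj₁ (p , q)) (inj₂ (p′ , q′)) = inj₂ (trans (cong (σ x) p) p′ , trans (cong (σ x) q) q′)
  MapsTo-∷ {x} (inj₂ (p , q)) (inj₁ (p′ , q′)) = inj₂ (trans (cong (σ x) p) q′ , trans (cong (σ x) q) p′)
  MapsTo-∷ {x} (inj₂ (p , q)) (inj₂ (p′ , q′)) = inj₁ (trans (cong (σ x) p) q′ , trans (cong (σ x) q) p′)

  MapsTo-[] : ∀ {a b} → MapsTo [] a b → a ≡ b
  MapsTo-[] (inj₁ (p , q)) = twist-level-injective (not-injective (cong proj₁ q)) (cong proj₂ p)
  MapsTo-[] {a} {b} (inj₂ (p , q)) = ⊥-elim (m≢1+m+n (level a) {1}
    (trans (cong proj₂ p) (trans (cong suc (sym (cong proj₂ q))) (cong suc (+-comm 1 (level a))))))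

  MapsTo-cancel : ∀ ws {s t u} → MapsTo ws s u → MapsTo ws t u → s ≡ t
  MapsTo-cancel ws (inj₁ (p , q)) (inj₁ (p′ , q′)) =
    MapsTo-[] (inj₁ (actW-injective ws (trans p (sym p′)) , actW-injective ws (trans q (sym q′))))
  MapsTo-cancel ws (inj₁ (p , q)) (inj₂ (p′ , q′)) =
    MapsTo-[] (inj₂ (actW-injective ws (trans p (sym q′)) , actW-injective ws (trans q (sym p′))))
  MapsTo-cancel ws (inj₂ (p , q)) (inj₁ (p′ , q′)) =
    MapsTo-[] (inj₂ (actW-injective ws (trans p (sym q′)) , actW-injective ws (trans q (sym p′))))
  MapsTo-cancel ws (inj₂ (p , q)) (inj₂ (p′ , q′)) =
    MapsTo-[] (inj₁ (actW-injective ws (trans p (sym p′)) , actW-injective ws (trans q (sym q′))))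

  -- The twins need a case of their own: they move the same two indices, and each exchanges the two
  -- summands of the other's root. Otherwise `a` fixes both summands.
  ⌿⇒MapsTo : ∀ {a b} → a ⌿ b → MapsTo [ a ] b b
  ⌿⇒MapsTo {a} {b} (a≢b , a≁b) with level a ≟ level b
  ... | yes l≡ = inj₂ (first , second)
    where
    t≢ : twist a ≢ twist b
    t≢ t≡ = a≢b (twist-level-injective t≡ l≡)
    first : σ a (α₁ b) ≡ α₂ b
    first = trans (cong (λ l → σ a (false , l)) (sym l≡))
      (trans (swap±-≡ {twist a} (lower false)) (cong₂ _,_ (¬-not t≢) (cong suc l≡)))
    not-xor-≢ : ∀ {b c} → c ≢ b → not b xor c ≡ false
    not-xor-≢ {false} {false} h = ⊥-elim (h refl)
    not-xor-≢ {false} {true} h = refl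
    not-xor-≢ {true} {false} h = refl
    not-xor-≢ {true} {true} h = ⊥-elim (h refl)
    second : σ a (α₂ b) ≡ α₁ b
    second = trans (cong (λ l → σ a (not (twist b) , suc l)) (sym l≡))
      (trans (swap±-≡ {twist a} (upper (not (twist b)))) (cong₂ _,_ (not-xor-≢ t≢) l≡))
  ... | no l≢ = inj₁ (swap±-≡ {twist a} (fixed (l≢ ∘ sym) (a≁b ∘ inj₁ ∘ sym))
                    , swap±-≡ {twist a} (fixed (a≁b ∘ inj₂) (l≢ ∘ sym ∘ suc-injective)))

  —⇒¬MapsTo : ∀ {a b} → a — b → ¬ MapsTo [ a ] b b
  —⇒¬MapsTo {a} {b} (inj₁ eq) h = not-in h (cong proj₂ (trans (cong (λ l → σ a (false , l)) (sym eq)) (swap±-≡ {twist a} (upper false))))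
    where
    not-in : MapsTo [ a ] b b → proj₂ (σ a (α₁ b)) ≢ level a
    not-in (inj₁ (p , _)) q = 1+n≢n (trans eq (trans (sym (cong proj₂ p)) q))
    not-in (inj₂ (p , _)) q = <⇒≢ (m<n⇒m<1+n (≤-reflexive eq)) (sym (trans (sym (cong proj₂ p)) q))
  —⇒¬MapsTo {a} {b} (inj₂ eq) h = not-in h (cong proj₂ (trans (cong (λ l → σ a (not (twist b) , l)) eq) (swap±-≡ {twist a} (lower (not (twist b))))))
    where
    not-in : MapsTo [ a ] b b → proj₂ (σ a (α₂ b)) ≢ suc (level a)
    not-in (inj₁ (_ , p)) q = 1+n≢n (trans (cong suc eq) (trans (sym q) (cong proj₂ p)))
    not-in (inj₂ (_ , p)) q = <⇒≢ (m<n⇒m<1+n (≤-reflexive eq)) (trans (sym (cong proj₂ p)) q)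

  MapsTo⇒⌿ : ∀ {a b} → a ≢ b → MapsTo [ a ] b b → a ⌿ b
  MapsTo⇒⌿ a≢b h = a≢b , λ adj → —⇒¬MapsTo adj h

  ascent-≢ : ∀ {s t} → s ≢ t → ascent [ s ] t ≡ true
  ascent-≢ {s} {t} s≢t with ascent [ s ] t in eq
  ... | true = refl
  ... | false = ⊥-elim (s≢t (sym (MapsTo-[] (ascent-cons s [] t (ascent-[] t) eq))))

  [_]-injective : ∀ {s t} → [ s ] ≋ [ t ] → s ≡ t
  [_]-injective {s} {t} eq with s Fin.≟ t
  ... | yes s≡t = s≡t
  ... | no s≢t = ⊥-elim (true≢false (trans (sym (ascent-≢ s≢t))
    (trans (ascent-resp t eq) (trans (ascent-snoc-same [] t) (cong not (ascent-[] t))))))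

  ++-cancelʳ-≋ : ∀ us ws t → us ++ [ t ] ≋ ws ++ [ t ] → us ≋ ws
  ++-cancelʳ-≋ us ws t eq = ≋-trans (≋-sym (cancel-last us t)) (≋-trans (++-congʳ [ t ] eq) (cancel-last ws t))

  -- Inverting gives `u a = t b`. So `a` is a descent of `t b` but not of `b`, and therefore `b`
  -- carries the root of `a` to that of `t`. Then `b a = t b = u a`, and cancelling `a` leaves
  -- `u = b`. Applied with the two sides exchanged, the same argument yields `t = a`.
  half-braid : ∀ {a b t u} → a ≢ b → u ≢ a → b ∷ [ t ] ≋ a ∷ [ u ] → MapsTo [ b ] a t × u ≡ b
  half-braid {a} {b} {t} {u} a≢b u≢a eq = maps ,
      [_]-injective (++-cancelʳ-≋ [ u ] [ b ] a (≋-trans inverted (≋-sym (conj-σ [ b ] a t maps))))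
    where
    inverted : u ∷ [ a ] ≋ t ∷ [ b ]
    -- The hypothesis is evaluated at the image of `z` under `t b`, where its left side cancels to
    -- `z`.
    inverted .at z = trans
      (cong (σ u ∘ σ a) (trans (sym (trans (cong (σ b) (σ-involutive t (σ b z))) (σ-involutive b z))) (at eq (σ t (σ b z)))))
      (trans (cong (σ u) (σ-involutive a _)) (σ-involutive u _))
    maps : MapsTo [ b ] a t
    maps = ascent-cons t [ b ] a (ascent-≢ (a≢b ∘ sym))
      (trans (sym (ascent-resp a inverted)) (trans (ascent-snoc-same [ u ] a) (cong not (ascent-≢ u≢a))))

  -- Two distinct covers of u lie below a common element of length ℓ(u) + 2 only if the generators commute.
  common-cover : ∀ {a b t u} → a ≢ b → b ≢ t → b ∷ [ t ] ≋ a ∷ [ u ] → t ≡ a × u ≡ b × b ⌿ a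
  common-cover {a} {b} {t} {u} a≢b b≢t eq with u Fin.≟ a
  ... | yes refl = ⊥-elim (b≢t ([_]-injective (++-cancelʳ-≋ [ b ] [ t ] t
    (≋-trans eq (≋-trans (cancel-last [] u) (≋-sym (cancel-last [] t)))))))
  ... | no u≢a with half-braid a≢b u≢a eq | half-braid (a≢b ∘ sym) (b≢t ∘ sym) (≋-sym eq)
  ...   | maps , u≡b | _ , refl = refl , u≡b , MapsTo⇒⌿ (a≢b ∘ sym) maps

  MapsTo-far : ∀ {s ws} → All (s ⌿_) ws → MapsTo ws s s
  MapsTo-far [] = inj₁ (refl , refl)
  MapsTo-far {s} {x ∷ ws} (p ∷ ps) = MapsTo-∷ {x} {ws} {s} {s} {s} (MapsTo-far ps) (⌿⇒MapsTo (⌿-sym p))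

  ascent-++ : ∀ r ws t s → MapsTo ws t s → ascent (r ++ ws) t ≡ ascent r s
  ascent-++ r ws t s (inj₁ (p , q)) = cong₂ positive
    (trans (actW-++ r ws (α₁ t)) (cong (actW r) p)) (trans (actW-++ r ws (α₂ t)) (cong (actW r) q))
  ascent-++ r ws t s (inj₂ (p , q)) = trans (cong₂ positive
    (trans (actW-++ r ws (α₁ t)) (cong (actW r) p)) (trans (actW-++ r ws (α₂ t)) (cong (actW r) q)))
    (positive-sym (actW r (α₂ s)) (actW r (α₁ s)) (index-≢ (actW-neg r) (actW-injective r) (α₂ s) (α₁ s) 1+n≢n))

  Far : Word → Set
  Far = AllPairs _⌿_

  Far⇒Unique : ∀ {J} → Far J → Unique J
  Far⇒Unique = AllPairs.map proj₁

  -- The sign at `t` could change only at a letter `s` whose tail carries the root of `t` to that of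
  -- `s`. The tail commutes with `s` and fixes the root of `s`, so `t` would be `s`.
  ascent-far : ∀ {J} t → Far J → t ∉ J → ascent J t ≡ true
  ascent-far {[]} t _ _ = ascent-[] t
  ascent-far {s ∷ J} t (s⌿J ∷ far) t∉ with ascent (s ∷ J) t in eq
  ... | true = refl
  ... | false = ⊥-elim (t∉ (here (MapsTo-cancel J
    (ascent-cons s J t (ascent-far t far (t∉ ∘ there)) eq) (MapsTo-far s⌿J))))

  ↭⇒≋ : ∀ {J K} → Far J → J ↭ K → J ≋ K
  ↭⇒≋ far refl = ≋-refl
  ↭⇒≋ (_ ∷ far) (prep x p) = ++-congˡ [ x ] (↭⇒≋ far p)
  ↭⇒≋ {x ∷ y ∷ J} {_ ∷ _ ∷ K} ((x⌿y ∷ _) ∷ _ ∷ far) (swap x y p) =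
    ≋-trans (++-congˡ (x ∷ y ∷ []) (↭⇒≋ far p)) (++-congʳ K (conj-σ [ x ] y y (⌿⇒MapsTo x⌿y)))
  ↭⇒≋ far (_↭_.trans p q) = ≋-trans (↭⇒≋ far p) (↭⇒≋ (AllPairs-resp-↭ ⌿-sym p far) q)

  -- Appending `s` keeps the remaining letters ascents, because `s` fixes their roots.
  reduced-far : ∀ {r J} → Reduced r → All (λ t → ascent r t ≡ true) J → Far J → Reduced (r ++ J)
  reduced-far {r} {[]} red _ _ = subst Reduced (sym (++-identityʳ r)) red
  reduced-far {r} {s ∷ J} red (asc ∷ ascs) (s⌿J ∷ far) = subst Reduced (++-assoc r [ s ] J)
    (reduced-far (reduced-snoc s red asc)
      (All.zipWith (λ {t} (p , q) → trans (ascent-++ r [ s ] t t (⌿⇒MapsTo p)) q) (s⌿J , ascs)) far)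

  last∈far : ∀ {J} q t → Far J → Reduced (q ++ [ t ]) → q ++ [ t ] ≋ J → t ∈ J
  last∈far {J} q t far red eq with _∈?_ Fin._≟_ t J
  ... | yes t∈J = t∈J
  ... | no t∉J = ⊥-elim (true≢false (trans (sym (ascent-far t far t∉J)) (trans (sym (ascent-resp t eq))
      (trans (ascent-snoc-same q t) (cong not (reduced-snoc⇒ascent q t red))))))

  far≋[] : ∀ {J} → Far J → [] ≋ J → J ≡ []
  far≋[] {[]} _ _ = refl
  far≋[] {J@(_ ∷ _)} far eq = ⊥-elim (n≮0 (reduced-far {[]} {J} reduced-[] (All.universal ascent-[] J) far eq))

  extract : ∀ {J t} → Far J → t ∈ J → ∃ λ K → Far K × J ↭ K ++ [ t ]
  extract {t = t} far t∈J with ∈-∃++ t∈J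
  ... | J₁ , J₂ , refl = J₁ ++ J₂ , AllPairs.tail (AllPairs-resp-↭ ⌿-sym (shift t J₁ J₂) far) ,
    ↭-trans (shift t J₁ J₂) (∷↭∷ʳ t (J₁ ++ J₂))

  -- The last letter of q is a descent of J, hence belongs to J by ascent-far.
  reduced-word-far : ∀ {q J} → Far J → Reduced q → q ≋ J → q ↭ J
  reduced-word-far {q} {J} far red eq = go (length q) q J far red eq refl
    where
    go : ∀ k q J → Far J → Reduced q → q ≋ J → length q ≡ k → q ↭ J
    go k q J far red eq len with initLast q
    go k _ J far red eq len | [] = subst ([] ↭_) (sym (far≋[] far eq)) ↭-refl
    go zero _ J far red eq len | q′ ∷ʳ′ t = ⊥-elim (1+n≢0 (trans (sym (length-snoc q′ t)) len))
    go (suc k) _ J far red eq len | q′ ∷ʳ′ t with extract far (last∈far q′ t far red eq)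
    ... | K , farK , J↭ = ↭-trans
      (++⁺ʳ [ t ] (go k q′ K farK (reduced-++ˡ q′ [ t ] red)
        (++-cancelʳ-≋ q′ K t (≋-trans eq (↭⇒≋ far J↭)))
        (suc-injective (trans (sym (length-snoc q′ t)) len))))
      (↭-sym J↭)

-- Weak order

unique-⊆⇒↭-++ : ∀ {A : Set} {xs ys : List A} → Unique xs → xs ⊆ ys → ∃ λ zs → ys ↭ xs ++ zs
unique-⊆⇒↭-++ {xs = []} {ys} _ _ = ys , ↭-refl
unique-⊆⇒↭-++ {xs = x ∷ xs} {ys} u@(_ ∷ u′) xs⊆ys with ∈-∃++ (xs⊆ys (here refl))
... | as , bs , refl with unique-⊆⇒↭-++ {ys = as ++ bs} u′ (λ {y} y∈xs → drop y y∈xs (∈-resp-↭ (shift x as bs) (xs⊆ys (there y∈xs))))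
  where
  drop : ∀ y → y ∈ xs → y ∈ x ∷ as ++ bs → y ∈ as ++ bs
  drop y y∈xs (here refl) = ⊥-elim (Unique.Unique[x∷xs]⇒x∉xs u y∈xs)
  drop y y∈xs (there y∈) = y∈
...   | zs , p = zs , ↭-trans (shift x as bs) (prep x p)

unique-set⇒↭ : ∀ {A : Set} {xs ys : List A} → Unique xs → Unique ys → xs ⊆ ys → ys ⊆ xs → xs ↭ ys
unique-set⇒↭ {xs = xs} ux uy xs⊆ys ys⊆xs with unique-⊆⇒↭-++ ux xs⊆ys
... | [] , p = ↭-sym (↭-trans p (subst (xs ++ [] ↭_) (++-identityʳ xs) ↭-refl))
... | z ∷ zs , p = ⊥-elim (Unique.Unique[x∷xs]⇒x∉xs {xs = xs ++ zs}
    (AllPairs-resp-↭ (_∘ sym) (↭-trans p (shift z xs zs)) uy)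
    (∈-++⁺ˡ (ys⊆xs (∈-resp-↭ (↭-sym (↭-trans p (shift z xs zs))) (here refl)))))

AllPairs-++⁻ˡ : ∀ {A : Set} {R : A → A → Set} xs {ys} → AllPairs R (xs ++ ys) → AllPairs R xs
AllPairs-++⁻ˡ [] _ = []
AllPairs-++⁻ˡ (x ∷ xs) (px ∷ pxs) = All.++⁻ˡ xs px ∷ AllPairs-++⁻ˡ xs pxs

select : ∀ {A : Set} (xs : List A) → Subset (length xs) → List A
select [] Vec.[] = []
select (x ∷ xs) (inside Vec.∷ p) = x ∷ select xs p
select (x ∷ xs) (outside Vec.∷ p) = select xs p

All-select : ∀ {A : Set} {P : A → Set} {xs} p → All P xs → All P (select xs p)
All-select Vec.[] [] = []
All-select (inside Vec.∷ p) (px ∷ pxs) = px ∷ All-select p pxs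
All-select (outside Vec.∷ p) (px ∷ pxs) = All-select p pxs

AllPairs-select : ∀ {A : Set} {R : A → A → Set} {xs} p → AllPairs R xs → AllPairs R (select xs p)
AllPairs-select Vec.[] [] = []
AllPairs-select (inside Vec.∷ p) (px ∷ pxs) = All-select p px ∷ AllPairs-select p pxs
AllPairs-select (outside Vec.∷ p) (px ∷ pxs) = AllPairs-select p pxs

∈-select⁺ : ∀ {A : Set} (xs : List A) {p i} → i ∈ˢ p → lookup xs i ∈ select xs p
∈-select⁺ (x ∷ xs) {i = zero} Vec.here = here refl
∈-select⁺ (x ∷ xs) {inside Vec.∷ p} (Vec.there i∈p) = there (∈-select⁺ xs i∈p)
∈-select⁺ (x ∷ xs) {outside Vec.∷ p} (Vec.there i∈p) = ∈-select⁺ xs i∈p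

∈-select⁻ : ∀ {A : Set} (xs : List A) p {x} → x ∈ select xs p → ∃ λ i → i ∈ˢ p × lookup xs i ≡ x
∈-select⁻ [] Vec.[] ()
∈-select⁻ (x ∷ xs) (inside Vec.∷ p) (here refl) = zero , Vec.here , refl
∈-select⁻ (x ∷ xs) (inside Vec.∷ p) (there y∈) with ∈-select⁻ xs p y∈
... | i , i∈p , eq = suc i , Vec.there i∈p , eq
∈-select⁻ (x ∷ xs) (outside Vec.∷ p) y∈ with ∈-select⁻ xs p y∈
... | i , i∈p , eq = suc i , Vec.there i∈p , eq

lookup-injective : ∀ {A : Set} {xs : List A} → Unique xs → ∀ {i j} → lookup xs i ≡ lookup xs j → i ≡ j
lookup-injective u@(_ ∷ _) {zero} {zero} _ = refl
lookup-injective {xs = x ∷ xs} u@(_ ∷ _) {zero} {suc j} eq = ⊥-elim (Unique.Unique[x∷xs]⇒x∉xs u (subst (_∈ xs) (sym eq) (∈-lookup j)))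
lookup-injective {xs = x ∷ xs} u@(_ ∷ _) {suc i} {zero} eq = ⊥-elim (Unique.Unique[x∷xs]⇒x∉xs u (subst (_∈ xs) eq (∈-lookup i)))
lookup-injective (_ ∷ u) {suc i} {suc j} eq = cong suc (lookup-injective u eq)

select-⊆⁺ : ∀ {A : Set} (xs : List A) {p q} → p ⊆ˢ q → select xs p ⊆ select xs q
select-⊆⁺ xs {p} {q} p⊆q x∈ with ∈-select⁻ xs p x∈
... | i , i∈p , refl = ∈-select⁺ xs (p⊆q i∈p)

select-⊆⁻ : ∀ {A : Set} {xs : List A} {p q} → Unique xs → select xs p ⊆ select xs q → p ⊆ˢ q
select-⊆⁻ {xs = xs} {p} {q} u h {i} i∈p with ∈-select⁻ xs q (h (∈-select⁺ xs i∈p))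
... | j , j∈q , eq = subst (_∈ˢ q) (lookup-injective u eq) j∈q

mask : ∀ {A : Set} {P : A → Set} → (∀ x → Dec (P x)) → (xs : List A) → Subset (length xs)
mask P? [] = Vec.[]
mask P? (x ∷ xs) = does (P? x) Vec.∷ mask P? xs

select-mask : ∀ {A : Set} {P : A → Set} (P? : ∀ x → Dec (P x)) xs → select xs (mask P? xs) ≡ filter P? xs
select-mask P? [] = refl
select-mask P? (x ∷ xs) with does (P? x)
... | true = cong (x ∷_) (select-mask P? xs)
... | false = select-mask P? xs

module WeakOrder (m : ℕ) where
  open Commutation m public

  reduced⇒IsLength : ∀ {r} → Reduced r → IsLength n (el r) (length r)
  reduced⇒IsLength {r} red = (r , sym (el≡prod r) , refl) ,
    λ ws eq → red {ws} (el≡⇒≋ (trans (el≡prod ws) eq))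

  IsLength-unique : ∀ {u a b} → IsLength n u a → IsLength n u b → a ≡ b
  IsLength-unique ((ws , p , refl) , min) ((ws′ , p′ , refl) , min′) = ≤-antisym (min ws′ p′) (min′ ws p)

  WLe-intro : ∀ a b → Reduced (a ++ b) → WLe n (el a) (el (a ++ b))
  WLe-intro a b red = el b , (b , sym (el≡prod b)) , mul-el a b , length a , length b , length (a ++ b) ,
    reduced⇒IsLength (reduced-++ˡ a b red) , reduced⇒IsLength (reduced-++ʳ a b red) , reduced⇒IsLength red , length-++ a

  -- Additivity of lengths says exactly that shortest words for `u` and for the quotient concatenate
  -- to a reduced word; from here on the weak order is the prefix order of reduced words.
  WLe-elim : ∀ {u w} → WLe n u w → ∃₂ λ a b → Reduced (a ++ b) × u ≡ el a × w ≡ el (a ++ b)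
  WLe-elim {w = w} (_ , _ , refl , _ , _ , _ , ((a , refl , refl) , _) , ((b , refl , refl) , _) , (_ , min) , refl) =
    a , b , (λ {us} eq → subst (_≤ length us) (sym (length-++ a))
      (min us (trans (sym (el≡prod us)) (trans (≋⇒el≡ eq) (sym mul≡))))) ,
    sym (el≡prod a) , mul≡
    where
    mul≡ : mul (prod n a) (prod n b) ≡ el (a ++ b)
    mul≡ = trans (sym (cong₂ mul (el≡prod a) (el≡prod b))) (mul-el a b)

  -- Reduced words of one element have equal length, so the prefix may be replaced by any chosen
  -- one.
  WLe-elimˡ : ∀ {r w} → Reduced r → WLe n (el r) w → ∃ λ b → Reduced (r ++ b) × w ≡ el (r ++ b)
  WLe-elimˡ {r} red le with WLe-elim le
  ... | a , b , red-ab , r≡a , refl =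
    b , reduced-resp (++-congʳ b r≋a) (≤-reflexive lengths) red-ab , ≋⇒el≡ (++-congʳ b (≋-sym r≋a))
    where
    r≋a : r ≋ a
    r≋a = el≡⇒≋ r≡a
    lengths : length (r ++ b) ≡ length (a ++ b)
    lengths = trans (length-++ r) (trans
      (cong (_+ length b) (reduced-length r≋a red (reduced-++ˡ a b red-ab))) (sym (length-++ a)))

  WLe-refl : ∀ {r} → Reduced r → WLe n (el r) (el r)
  WLe-refl {r} red = subst (WLe n (el r) ∘ el) (++-identityʳ r)
    (WLe-intro r [] (subst Reduced (sym (++-identityʳ r)) red))

  WLe-reflʳ : ∀ {u w} → WLe n u w → WLe n w w
  WLe-reflʳ le with WLe-elim le
  ... | a , b , red , _ , refl = WLe-refl red

  WLe-trans : ∀ {u w x} → WLe n u w → WLe n w x → WLe n u x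
  WLe-trans le le′ with WLe-elim le
  ... | a , b , red , refl , refl with WLe-elimˡ red le′
  ...   | c , red′ , refl = subst (WLe n (el a) ∘ el) (sym (++-assoc a b c))
    (WLe-intro a (b ++ c) (subst Reduced (++-assoc a b c) red′))

  length-≡⇒[] : ∀ (a b : Word) → length (a ++ b) ≡ length a → b ≡ []
  length-≡⇒[] a [] _ = refl
  length-≡⇒[] a (x ∷ b) eq = ⊥-elim (m≢1+m+n (length a) (trans (sym eq) (trans (length-++ a) (+-suc (length a) (length b)))))

  WLe-antisym : ∀ {u w} → WLe n u w → WLe n w u → u ≡ w
  WLe-antisym le le′ with WLe-elim le
  ... | a , b , red , refl , refl with WLe-elimˡ red le′
  ...   | c , red′ , eq with length-≡⇒[] a (b ++ c)
    (sym (trans (reduced-length (el≡⇒≋ eq) (reduced-++ˡ a b red) red′) (cong length (++-assoc a b c))))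
  ...     | bc≡[] with b
  ...       | [] = cong el (sym (++-identityʳ a))

  Ascents : Word → Word → Set
  Ascents r = All (λ t → ascent r t ≡ true)

  NonDes⇔ascent : ∀ {r} → Reduced r → ∀ t → NonDes n (el r) t ⇔ (ascent r t ≡ true)
  NonDes⇔ascent {r} red t = mk⇔ to from
    where
    v·t : mul (el r) (gen n t) ≡ el (r ++ [ t ])
    v·t = trans (cong (mul (el r)) (trans (gen-σ t) (sym (el-toEl [ t ])))) (mul-el r [ t ])
    to : NonDes n (el r) t → ascent r t ≡ true
    to nondes with ascent r t in eq
    ... | true = refl
    ... | false with reduced-descent t red eq
    ...   | r′ , red′ , h , len = ⊥-elim (nondes (length r′ , length r ,
      subst (λ u → IsLength n u (length r′)) (trans (≋⇒el≡ h) (sym v·t)) (reduced⇒IsLength red′) ,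
      reduced⇒IsLength red , ≤-reflexive (sym len)))
    from : ascent r t ≡ true → NonDes n (el r) t
    from asc (a , b , la , lb , a<b) = <-asym a<b (≤-reflexive (trans (cong suc b≡)
      (trans (sym (length-snoc r t)) (sym a≡))))
      where
      a≡ : a ≡ length (r ++ [ t ])
      a≡ = IsLength-unique (subst (λ u → IsLength n u a) v·t la) (reduced⇒IsLength (reduced-snoc t red asc))
      b≡ : b ≡ length r
      b≡ = IsLength-unique lb (reduced⇒IsLength red)

  module _ {r : Word} (red : Reduced r) where

    WLe-far : ∀ {K L} → Far K → Far L → Ascents r L → K ⊆ L → WLe n (el (r ++ K)) (el (r ++ L))
    WLe-far {K} {L} farK farL asc K⊆L with unique-⊆⇒↭-++ (Far⇒Unique farK) K⊆L
    ... | M , p = subst₂ (WLe n) refl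
      (trans (cong el (++-assoc r K M)) (≋⇒el≡ (++-congˡ r (≋-sym (↭⇒≋ farL p)))))
      (WLe-intro (r ++ K) M (subst Reduced (sym (++-assoc r K M))
        (reduced-far red (All-resp-↭ p asc) (AllPairs-resp-↭ ⌿-sym p farL))))

    WLe-far⁻ : ∀ {K L} → Far K → Far L → Ascents r K →
      WLe n (el (r ++ K)) (el (r ++ L)) → K ⊆ L
    WLe-far⁻ {K} {L} farK farL asc le x∈K with WLe-elimˡ (reduced-far red asc farK) le
    ... | b , red′ , eq = ∈-resp-↭ (reduced-word-far farL
        (reduced-++ʳ r (K ++ b) (subst Reduced (++-assoc r K b) red′))
        (++-cancelˡ-≋ r (≋-trans (≡⇒≋ (sym (++-assoc r K b))) (≋-sym (el≡⇒≋ eq)))))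
      (∈-++⁺ˡ x∈K)

    far⇒WLe : ∀ {J} → Far J → Ascents r J → WLe n (el r) (el (r ++ J))
    far⇒WLe {J} far asc = WLe-intro r J (reduced-far red asc far)

    far⇒Boolean : ∀ {J} → Far J → Ascents r J → BooleanInterval n (el r) (el (r ++ J))
    far⇒Boolean {J} far asc = length J , f , between , onto , monotone
      where
      f : Subset (length J) → El
      f A = el (r ++ select J A)
      farˢ : ∀ A → Far (select J A)
      farˢ A = AllPairs-select A far
      ascˢ : ∀ A → Ascents r (select J A)
      ascˢ A = All-select A asc
      between : ∀ A → WLe n (el r) (f A) × WLe n (f A) (el (r ++ J))
      between A = far⇒WLe (farˢ A) (ascˢ A) , WLe-far (farˢ A) far asc sub
        where
        sub : select J A ⊆ J
        sub x∈ with ∈-select⁻ J A x∈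
        ... | i , _ , refl = ∈-lookup i
      onto : ∀ u → WLe n (el r) u → WLe n u (el (r ++ J)) → ∃ λ A → f A ≡ u
      onto u le le′ with WLe-elimˡ red le
      ... | y , red-y , refl with WLe-elimˡ red-y le′
      -- `y ++ z` is a reduced word for `J`, hence a rearrangement of it; the subset consists of the
      -- positions of `J` whose letter occurs in `y`.
      ...   | z , red-z , eq = mask (λ x → _∈?_ Fin._≟_ x y) J ,
        trans (cong (λ K → el (r ++ K)) (select-mask (λ x → _∈?_ Fin._≟_ x y) J)) (≋⇒el≡ (++-congˡ r
          (↭⇒≋ (AllPairs.filter⁺ _ far) (unique-set⇒↭ (Unique.filter⁺ _ (Far⇒Unique far)) uy
            (λ x∈ → proj₂ (∈-filter⁻ _ {xs = J} x∈)) (λ x∈ → ∈-filter⁺ _ (∈-resp-↭ yz↭J (∈-++⁺ˡ x∈)) x∈)))))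
        where
        yz↭J : y ++ z ↭ J
        yz↭J = reduced-word-far far (reduced-++ʳ r (y ++ z) (subst Reduced (++-assoc r y z) red-z))
          (++-cancelˡ-≋ r (≋-trans (≡⇒≋ (sym (++-assoc r y z))) (≋-sym (el≡⇒≋ eq))))
        uy : Unique y
        uy = AllPairs-++⁻ˡ y (AllPairs-resp-↭ (_∘ sym) (↭-sym yz↭J) (Far⇒Unique far))
      monotone : ∀ A B → (A ⊆ˢ B) ⇔ WLe n (f A) (f B)
      monotone A B = mk⇔ to from
        where
        to : A ⊆ˢ B → WLe n (f A) (f B)
        to A⊆B = WLe-far (farˢ A) (farˢ B) (ascˢ B) (select-⊆⁺ J {A} {B} A⊆B)
        from : WLe n (f A) (f B) → A ⊆ˢ B
        from le = select-⊆⁻ {xs = J} {A} {B} (Far⇒Unique far) (WLe-far⁻ (farˢ A) (farˢ B) (ascˢ A) le)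

-- Generators of a Boolean interval

module BooleanIntervals (m : ℕ) where
  open WeakOrder m public

  module Extract {r : Word} (red : Reduced r) {w : El} {k : ℕ} (f : Subset k → El)
    (between : ∀ A → WLe n (el r) (f A) × WLe n (f A) w)
    (onto : ∀ u → WLe n (el r) u → WLe n u w → ∃ λ A → f A ≡ u)
    (monotone : ∀ A B → (A ⊆ˢ B) ⇔ WLe n (f A) (f B))
    (v≤w : WLe n (el r) w) where

    f-⊆ : ∀ A B → WLe n (f A) (f B) → A ⊆ˢ B
    f-⊆ A B = Equivalence.from (monotone A B)

    f-mono : ∀ A B → A ⊆ˢ B → WLe n (f A) (f B)
    f-mono A B = Equivalence.to (monotone A B)

    f-injective : ∀ {A B} → f A ≡ f B → A ≡ B
    f-injective {A} {B} eq = Subset.⊆-antisym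
      (f-⊆ A B (subst (WLe n (f A)) eq refl-A)) (f-⊆ B A (subst (λ u → WLe n u (f A)) eq refl-A))
      where
      refl-A : WLe n (f A) (f A)
      refl-A = WLe-reflʳ (proj₁ (between A))

    f-⊥ : f ⊥ˢ ≡ el r
    f-⊥ with onto (el r) (WLe-refl red) v≤w
    ... | A , eq = WLe-antisym (subst (WLe n (f ⊥ˢ)) eq (f-mono ⊥ˢ A Subset.⊥⊆)) (proj₁ (between ⊥ˢ))

    f-⊤ : f ⊤ˢ ≡ w
    f-⊤ with onto w v≤w (WLe-reflʳ v≤w)
    ... | A , eq = WLe-antisym (proj₂ (between ⊤ˢ)) (subst (λ u → WLe n u (f ⊤ˢ)) eq (f-mono A ⊤ˢ Subset.⊆⊤))

    -- The element reached after the first letter `t` of the increment lies in the interval, so it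
    -- is `f C` with `C` between `A` and `⁅ i ⁆ ∪ A`. It is longer than `f A`, so `C` is not `A` and
    -- must be the upper set.
    cover-by : ∀ {A i a} b → i ∉ˢ A → Reduced a → f A ≡ el a → Reduced (a ++ b) →
      f (⁅ i ⁆ ∪ A) ≡ el (a ++ b) → ∃ λ t → f (⁅ i ⁆ ∪ A) ≡ el (a ++ [ t ]) × Reduced (a ++ [ t ])
    cover-by {A} {i} {a} [] i∉A red-a fA≡ _ fB≡ = ⊥-elim (i∉A (subst (i ∈ˢ_)
      (f-injective {⁅ i ⁆ ∪ A} {A} (trans fB≡ (trans (cong el (++-identityʳ a)) (sym fA≡))))
      (Subset.x∈p∪q⁺ (inj₁ (Subset.x∈⁅x⁆ i)))))
    cover-by {A} {i} {a} (t ∷ b) i∉A red-a fA≡ red-b fB≡ = result (i Subset.∈? C)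
      where
      B : Subset k
      B = ⁅ i ⁆ ∪ A
      red-b′ : Reduced ((a ++ [ t ]) ++ b)
      red-b′ = subst Reduced (sym (++-assoc a [ t ] b)) red-b
      red-t : Reduced (a ++ [ t ])
      red-t = reduced-++ˡ (a ++ [ t ]) b red-b′
      fA≤u : WLe n (f A) (el (a ++ [ t ]))
      fA≤u = subst (λ u → WLe n u (el (a ++ [ t ]))) (sym fA≡) (WLe-intro a [ t ] red-t)
      u≤fB : WLe n (el (a ++ [ t ])) (f B)
      u≤fB = subst (WLe n (el (a ++ [ t ]))) (sym (trans fB≡ (cong el (sym (++-assoc a [ t ] b)))))
        (WLe-intro (a ++ [ t ]) b red-b′)
      abstract
        middle : ∃ λ C → f C ≡ el (a ++ [ t ])
        middle = onto _ (WLe-trans (proj₁ (between A)) fA≤u) (WLe-trans u≤fB (proj₂ (between B)))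
      C : Subset k
      C = proj₁ middle
      A⊆C : A ⊆ˢ C
      A⊆C = f-⊆ A C (subst (WLe n (f A)) (sym (proj₂ middle)) fA≤u)
      C⊆B : C ⊆ˢ B
      C⊆B = f-⊆ C B (subst (λ u → WLe n u (f B)) (sym (proj₂ middle)) u≤fB)
      B⊆C : i ∈ˢ C → B ⊆ˢ C
      B⊆C i∈C x∈B with Subset.x∈p∪q⁻ ⁅ i ⁆ A x∈B
      ... | inj₁ x∈i = subst (_∈ˢ C) (sym (Subset.x∈⁅y⁆⇒x≡y i x∈i)) i∈C
      ... | inj₂ x∈A = A⊆C x∈A
      C⊆A : i ∉ˢ C → C ⊆ˢ A
      C⊆A i∉C x∈C with Subset.x∈p∪q⁻ ⁅ i ⁆ A (C⊆B x∈C)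
      ... | inj₁ x∈i = ⊥-elim (i∉C (subst (_∈ˢ C) (Subset.x∈⁅y⁆⇒x≡y i x∈i) x∈C))
      ... | inj₂ x∈A = x∈A
      result : Dec (i ∈ˢ C) → ∃ λ t → f B ≡ el (a ++ [ t ]) × Reduced (a ++ [ t ])
      result (yes i∈C) = t , trans (cong f (Subset.⊆-antisym (B⊆C i∈C) C⊆B)) (proj₂ middle) , red-t
      result (no i∉C) = ⊥-elim (m≢1+m+n (length a) {0} (trans
        (reduced-length (el≡⇒≋ {a} {a ++ [ t ]} (trans (sym fA≡)
          (trans (cong f (Subset.⊆-antisym A⊆C (C⊆A i∉C))) (proj₂ middle)))) red-a red-t)
        (trans (length-snoc a t) (cong suc (sym (+-identityʳ (length a)))))))

    cover : ∀ {A i a} → i ∉ˢ A → Reduced a → f A ≡ el a →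
      ∃ λ t → f (⁅ i ⁆ ∪ A) ≡ el (a ++ [ t ]) × Reduced (a ++ [ t ])
    cover {A} {i} {a} i∉A red-a fA≡
      with WLe-elimˡ red-a (subst (λ u → WLe n u (f (⁅ i ⁆ ∪ A))) fA≡
             (f-mono A (⁅ i ⁆ ∪ A) (Subset.q⊆p∪q ⁅ i ⁆ A)))
    ... | b , red-b , fB≡ = cover-by b i∉A red-a fA≡ red-b fB≡

    abstract
      -- The singleton is written as a union so that it is literally `setOf [ i ]` and serves
      -- unchanged as the base case of `claim`.
      atom : ∀ i → ∃ λ t → f (⁅ i ⁆ ∪ ⊥ˢ) ≡ el (r ++ [ t ]) × Reduced (r ++ [ t ])
      atom i = cover Subset.∉⊥ red f-⊥

    S : Fin k → V
    S i = proj₁ (atom i)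

    S-injective : ∀ {i j} → S i ≡ S j → i ≡ j
    S-injective {i} {j} eq with Subset.x∈p∪q⁻ ⁅ j ⁆ ⊥ˢ (subst (i ∈ˢ_)
        (f-injective (trans (proj₁ (proj₂ (atom i))) (trans (cong (λ t → el (r ++ [ t ])) eq) (sym (proj₁ (proj₂ (atom j)))))))
        (Subset.x∈p∪q⁺ {p = ⁅ i ⁆} {⊥ˢ} (inj₁ (Subset.x∈⁅x⁆ i))))
    ... | inj₁ i∈j = Subset.x∈⁅y⁆⇒x≡y j i∈j
    ... | inj₂ i∈⊥ = ⊥-elim (Subset.∉⊥ i∈⊥)

    setOf : List (Fin k) → Subset k
    setOf [] = ⊥ˢ
    setOf (i ∷ K) = ⁅ i ⁆ ∪ setOf K

    ∈-setOf⁻ : ∀ K {i} → i ∈ˢ setOf K → i ∈ K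
    ∈-setOf⁻ [] i∈ = ⊥-elim (Subset.∉⊥ i∈)
    ∈-setOf⁻ (j ∷ K) i∈ with Subset.x∈p∪q⁻ ⁅ j ⁆ (setOf K) i∈
    ... | inj₁ i∈j = here (Subset.x∈⁅y⁆⇒x≡y j i∈j)
    ... | inj₂ i∈K = there (∈-setOf⁻ K i∈K)

    ∈-setOf⁺ : ∀ {K i} → i ∈ K → i ∈ˢ setOf K
    ∈-setOf⁺ {j ∷ K} (here refl) = Subset.x∈p∪q⁺ (inj₁ (Subset.x∈⁅x⁆ j))
    ∈-setOf⁺ {j ∷ K} (there i∈K) = Subset.x∈p∪q⁺ {p = ⁅ j ⁆} (inj₂ (∈-setOf⁺ i∈K))

    setOf-swap : ∀ i j K → setOf (i ∷ j ∷ K) ≡ setOf (j ∷ i ∷ K)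
    setOf-swap i j K = trans (sym (Subset.∪-assoc ⁅ i ⁆ ⁅ j ⁆ (setOf K)))
      (trans (cong (_∪ setOf K) (Subset.∪-comm ⁅ i ⁆ ⁅ j ⁆)) (Subset.∪-assoc ⁅ j ⁆ ⁅ i ⁆ (setOf K)))

    -- The head of the list becomes the last letter, since it is the atom joined last.
    wordOf : List (Fin k) → Word
    wordOf [] = []
    wordOf (i ∷ K) = wordOf K ++ [ S i ]

    Claim : List (Fin k) → Set
    Claim K = f (setOf K) ≡ el (r ++ wordOf K) × Reduced (r ++ wordOf K)

    -- The elements over `i ∷ K` and `j ∷ K` are covered by the same element over `i ∷ j ∷ K`, with
    -- some letters `t′` and `t`. Cancelling the common prefix `P` gives `S j t = S i t′`, and
    -- `common-cover` identifies both letters.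
    square : ∀ i j K → Unique (i ∷ j ∷ K) → Claim (i ∷ K) → Claim (j ∷ K) → Claim (i ∷ j ∷ K) × S j ⌿ S i
    square i j K u@((i≢j ∷ _) ∷ uK) (fi , red-i) (fj , red-j)
      with cover {setOf (j ∷ K)} {i} (Unique.Unique[x∷xs]⇒x∉xs u ∘ ∈-setOf⁻ (j ∷ K)) red-j fj
         | cover {setOf (i ∷ K)} {j} (j∉ ∘ ∈-setOf⁻ (i ∷ K)) red-i fi
      where
      j∉ : j ∉ i ∷ K
      j∉ (here eq) = i≢j (sym eq)
      j∉ (there j∈K) = Unique.Unique[x∷xs]⇒x∉xs uK j∈K
    ... | t , ft , red-t | t′ , ft′ , _ = conclude (common-cover (i≢j ∘ S-injective) Sj≢t braid)
      where
      P : Word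
      P = r ++ wordOf K
      unfold : ∀ s x → (r ++ (wordOf K ++ [ s ])) ++ [ x ] ≡ P ++ s ∷ [ x ]
      unfold s x = trans (cong (_++ [ x ]) (sym (++-assoc r (wordOf K) [ s ]))) (++-assoc P [ s ] [ x ])
      braid : S j ∷ [ t ] ≋ S i ∷ [ t′ ]
      braid = ++-cancelˡ-≋ P (≋-trans (≡⇒≋ (sym (unfold (S j) t)))
        (≋-trans (el≡⇒≋ (trans (sym ft) (trans (cong f (setOf-swap i j K)) ft′))) (≡⇒≋ (unfold (S i) t′))))
      Sj≢t : S j ≢ t
      Sj≢t refl = n≮0 (reduced-++ʳ P (S j ∷ [ S j ]) (subst Reduced (unfold (S j) (S j)) red-t)
        (≋-sym (cancel-last [] (S j))))
      conclude : t ≡ S i × t′ ≡ S j × S j ⌿ S i → Claim (i ∷ j ∷ K) × S j ⌿ S i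
      conclude (refl , _ , far) = (trans ft (cong el assoc) , subst Reduced assoc red-t) , far
        where
        assoc : (r ++ wordOf (j ∷ K)) ++ [ S i ] ≡ r ++ wordOf (i ∷ j ∷ K)
        assoc = ++-assoc r (wordOf (j ∷ K)) [ S i ]

    claim-[] : Claim []
    claim-[] = trans f-⊥ (cong el (sym (++-identityʳ r))) , subst Reduced (sym (++-identityʳ r)) red

    -- The square rests on `i ∷ K` and `j ∷ K`; the first is not a tail of `i ∷ j ∷ K`, whence the
    -- induction on the length.
    claim : ∀ l K → length K ≡ l → Unique K → Claim K
    claim l [] len u = claim-[]
    claim l (i ∷ []) len u = proj₂ (atom i)
    claim (suc l) (i ∷ j ∷ K) len u@((_ ∷ i∉K) ∷ (j∉K ∷ uK)) = proj₁ (square i j K u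
      (claim l (i ∷ K) (suc-injective len) (i∉K ∷ uK)) (claim l (j ∷ K) (suc-injective len) (j∉K ∷ uK)))

    S-⌿ : ∀ {i j} → i ≢ j → S i ⌿ S j
    S-⌿ {i} {j} i≢j = ⌿-sym (proj₂ (square i j [] ((i≢j ∷ []) ∷ [] ∷ []) (proj₂ (atom i)) (proj₂ (atom j))))

    wordOf-↭ : ∀ K → wordOf K ↭ map S K
    wordOf-↭ [] = ↭-refl
    wordOf-↭ (i ∷ K) = ↭-trans (↭-sym (∷↭∷ʳ (S i) (wordOf K))) (prep (S i) (wordOf-↭ K))

    generators : Word
    generators = map S (allFin k)

    far : Far generators
    far = AllPairs.map⁺ (AllPairs.map S-⌿ (Unique.allFin⁺ k))

    ascents : Ascents r generators
    ascents = All.map⁺ (All.universal (λ i → reduced-snoc⇒ascent r (S i) (proj₂ (proj₂ (atom i)))) (allFin k))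

    top : w ≡ el (r ++ generators)
    top = trans (sym f-⊤) (trans
      (cong f (Subset.⊆-antisym {i = ⊤ˢ} {setOf (allFin k)} (λ {i} _ → ∈-setOf⁺ (∈-allFin i)) Subset.⊆⊤))
      (trans (proj₁ (claim k (allFin k) (length-tabulate id) (Unique.allFin⁺ k)))
        (≋⇒el≡ (++-congˡ r (≋-sym (↭⇒≋ far (↭-sym (wordOf-↭ (allFin k)))))))))

  Boolean⇒far : ∀ {r w} → Reduced r → WLe n (el r) w → BooleanInterval n (el r) w →
    ∃ λ J → Far J × Ascents r J × w ≡ el (r ++ J)
  Boolean⇒far red v≤w (k , f , between , onto , monotone) = generators , far , ascents , top
    where open Extract red f between onto monotone v≤w

-- Counting independent sets

-- Sublists of a fixed list serve as canonical representatives of sets of generators; this is what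
-- keeps the enumeration of intervals free of repetitions.
sublist-↭⇒≡ : ∀ {A : Set} {xs ys zs : List A} → Unique zs → xs ⊑ zs → ys ⊑ zs → xs ↭ ys → xs ≡ ys
sublist-↭⇒≡ _ [] [] _ = refl
sublist-↭⇒≡ (_ ∷ u) (_ ∷ʳ s) (_ ∷ʳ s′) p = sublist-↭⇒≡ u s s′ p
sublist-↭⇒≡ u@(_ ∷ _) (_ ∷ʳ s) (refl ∷ s′) p =
  ⊥-elim (Unique.Unique[x∷xs]⇒x∉xs u (Sublist.lookup s (∈-resp-↭ (↭-sym p) (here refl))))
sublist-↭⇒≡ u@(_ ∷ _) (refl ∷ s) (_ ∷ʳ s′) p =
  ⊥-elim (Unique.Unique[x∷xs]⇒x∉xs u (Sublist.lookup s′ (∈-resp-↭ p (here refl))))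
sublist-↭⇒≡ (_ ∷ u) (refl ∷ s) (refl ∷ s′) p = cong (_ ∷_) (sublist-↭⇒≡ u s s′ (drop-∷ p))

unique-map⁺ : ∀ {A B : Set} {f : A → B} {xs} → (∀ {x y} → x ∈ xs → y ∈ xs → f x ≡ f y → x ≡ y) →
  Unique xs → Unique (map f xs)
unique-map⁺ {xs = []} inj [] = []
unique-map⁺ {xs = x ∷ xs} inj (x≢ ∷ u) =
  All.map⁺ (All.tabulate (λ {y} y∈ eq → All.lookup x≢ y∈ (inj (here refl) (there y∈) eq))) ∷
  unique-map⁺ (λ x∈ y∈ → inj (there x∈) (there y∈)) u

module Independent {A : Set} {_~_ : A → A → Set} (_~?_ : Decidable _~_) (~-sym : Symmetric _~_) where

  adjacent : A → A → Bool
  adjacent x y = does (x ~? y)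

  adjacent-sym : ∀ x y → adjacent x y ≡ adjacent y x
  adjacent-sym x y with x ~? y
  ... | yes p = sym (dec-true (y ~? x) (~-sym p))
  ... | no ¬p = sym (dec-false (y ~? x) (¬p ∘ ~-sym))

  without : (A → Bool) → A → A → Bool
  without P x y = P y ∧ not (adjacent x y)

  -- P marks the vertices that are not adjacent to one chosen earlier.
  independents : (A → Bool) → List A → List (List A)
  independents P [] = [ [] ]
  independents P (x ∷ xs) = independents P xs ++
    (if P x then map (x ∷_) (independents (without P x) xs) else [])

  independents-sound : ∀ P xs {J} → J ∈ independents P xs →
    J ⊑ xs × All (λ x → P x ≡ true) J × AllPairs (λ x y → ¬ x ~ y) J
  independents-sound P [] (here refl) = [] , [] , []
  independents-sound P (x ∷ xs) J∈ with ∈-++⁻ (independents P xs) J∈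
  ... | inj₁ J∈′ with independents-sound P xs J∈′
  ...   | s , p , q = x ∷ʳ s , p , q
  independents-sound P (x ∷ xs) J∈ | inj₂ J∈′ with P x in eq
  ... | true with ∈-map⁻ (x ∷_) J∈′
  ...   | K , K∈ , refl with independents-sound (without P x) xs K∈
  ...     | s , p , q = refl ∷ s , eq ∷ All.map (proj₁ ∘ split) p , All.map (proj₂ ∘ split) p ∷ q
    where
    split : ∀ {y} → without P x y ≡ true → P y ≡ true × ¬ x ~ y
    split {y} h with P y | x ~? y
    ... | true | no ¬xy = refl , ¬xy

  independents-complete : ∀ P xs {J} → J ⊑ xs → All (λ x → P x ≡ true) J → AllPairs (λ x y → ¬ x ~ y) J →
    J ∈ independents P xs
  independents-complete P [] [] _ _ = here refl
  independents-complete P (x ∷ xs) (.x ∷ʳ s) p q = ∈-++⁺ˡ (independents-complete P xs s p q)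
  independents-complete P (x ∷ xs) (refl ∷ s) (px ∷ p) (qx ∷ q) rewrite px =
    ∈-++⁺ʳ (independents P xs) (∈-map⁺ (x ∷_) (independents-complete (without P x) xs s
      (All.zipWith (λ {y} (py , ¬xy) → cong₂ _∧_ py (cong not (dec-false (x ~? y) ¬xy))) (p , qx)) q))

  independents-unique : ∀ P xs → Unique xs → Unique (independents P xs)
  independents-unique P [] _ = [] ∷ []
  independents-unique P (x ∷ xs) u@(_ ∷ u′) with P x
  ... | false = Unique.++⁺ (independents-unique P xs u′) [] (λ ())
  ... | true = Unique.++⁺ (independents-unique P xs u′)
      (Unique.map⁺ ∷-injectiveʳ (independents-unique (without P x) xs u′)) disjoint
    where
    disjoint : ∀ {J} → J ∈ independents P xs × J ∈ map (x ∷_) (independents (without P x) xs) → ⊥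
    disjoint (J∈ , J∈′) with ∈-map⁻ (x ∷_) J∈′
    ... | K , _ , refl = Unique.Unique[x∷xs]⇒x∉xs u
      (Sublist.lookup (proj₁ (independents-sound P xs J∈)) (here refl))

  count : (A → Bool) → List A → ℕ
  count P [] = 1
  count P (x ∷ xs) = count P xs + (if P x then count (without P x) xs else 0)

  length-independents : ∀ P xs → length (independents P xs) ≡ count P xs
  length-independents P [] = refl
  length-independents P (x ∷ xs) = trans (length-++ (independents P xs))
    (cong₂ _+_ (length-independents P xs) tail)
    where
    tail : length (if P x then map (x ∷_) (independents (without P x) xs) else []) ≡
      (if P x then count (without P x) xs else 0)
    tail with P x
    ... | true = trans (length-map (x ∷_) (independents (without P x) xs)) (length-independents (without P x) xs)
    ... | false = refl

  count-cong : ∀ {P Q} xs → (∀ {y} → y ∈ xs → P y ≡ Q y) → count P xs ≡ count Q xs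
  count-cong [] eq = refl
  count-cong {P} {Q} (x ∷ xs) eq rewrite eq {x} (here refl)
    | count-cong {P} {Q} xs (eq ∘ there)
    | count-cong {without P x} {without Q x} xs (λ {y} y∈ → cong (_∧ not (adjacent x y)) (eq (there y∈))) = refl

  without-comm : ∀ P x y z → without (without P x) y z ≡ without (without P y) x z
  without-comm P x y z = trans (∧-assoc (P z) _ _)
    (trans (cong (P z ∧_) (∧-comm (not (adjacent x z)) _)) (sym (∧-assoc (P z) _ _)))

  count-swap : ∀ P x y xs → count P (x ∷ y ∷ xs) ≡ count P (y ∷ x ∷ xs)
  count-swap P x y xs rewrite adjacent-sym y x
    | count-cong {without (without P y) x} {without (without P x) y} xs (λ {z} _ → without-comm P y x z)
    with P x | P y
  ... | false | false = refl
  ... | false | true = interchange (count P xs) _ 0 0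
  ... | true | false = interchange (count P xs) 0 _ 0
  ... | true | true = interchange (count P xs) _ _ _

  -- Components are given in arbitrary order, while the recursion needs them listed by level.
  count-↭ : ∀ P {xs ys} → xs ↭ ys → count P xs ≡ count P ys
  count-↭ P refl = refl
  count-↭ P (prep x p) rewrite count-↭ P p | count-↭ (without P x) p = refl
  count-↭ P {_ ∷ _ ∷ xs} {_ ∷ _ ∷ ys} (swap x y p) = trans (count-swap P x y xs) (two p)
    where
    two : ∀ {xs ys} → xs ↭ ys → count P (y ∷ x ∷ xs) ≡ count P (y ∷ x ∷ ys)
    two p rewrite count-↭ P p | count-↭ (without P x) p | count-↭ (without P y) p
      | count-↭ (without (without P y) x) p = refl
  count-↭ P (_↭_.trans p q) = trans (count-↭ P p) (count-↭ P q)

  count-without : ∀ P {x} xs → All (λ y → ¬ x ~ y) xs → count (without P x) xs ≡ count P xs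
  count-without P {x} xs far = count-cong xs (λ {y} y∈ →
    trans (cong (λ b → P y ∧ not b) (dec-false (x ~? y) (All.lookup far y∈))) (∧-identityʳ (P y)))

  count-++ : ∀ P xs ys → All (λ x → All (λ y → ¬ x ~ y) ys) xs → count P (xs ++ ys) ≡ count P xs * count P ys
  count-++ P [] ys _ = sym (+-identityʳ _)
  count-++ P (x ∷ xs) ys (x≁ ∷ far) with P x
  ... | false = trans (+-identityʳ _) (trans (count-++ P xs ys far)
    (cong (_* count P ys) (sym (+-identityʳ (count P xs)))))
  ... | true = trans (cong₂ _+_ (count-++ P xs ys far) (trans (count-++ (without P x) xs ys far)
      (cong (count (without P x) xs *_) (count-without P ys x≁))))
    (sym (*-distribʳ-+ (count P ys) (count P xs) (count (without P x) xs)))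

  all : A → Bool
  all _ = true

  -- Sets avoiding the pendant vertex `x` are those of the rest; sets containing it must avoid its
  -- only neighbour `y`.
  count-pendant : ∀ x y zs → x ~ y → All (λ z → ¬ x ~ z) zs →
    count all (x ∷ y ∷ zs) ≡ count all (y ∷ zs) + count all zs
  count-pendant x y zs x~y far = cong (count all (y ∷ zs) +_) (trans
    (cong (λ b → count (without all x) zs + (if not b then count (without (without all x) y) zs else 0)) (dec-true (x ~? y) x~y))
    (trans (+-identityʳ _) (count-without all zs far)))

-- Components of the Coxeter graph

minimum-by : ∀ {A : Set} (f : A → ℕ) (xs : List A) {x} → x ∈ xs → ∃ λ y → y ∈ xs × (∀ z → z ∈ xs → f y ≤ f z)
minimum-by f (x ∷ []) _ = x , here refl , λ { _ (here refl) → ≤-refl }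
minimum-by f (x ∷ xs@(_ ∷ _)) _ with minimum-by f xs (here refl)
... | y , y∈ , min with f x ≤? f y
...   | yes x≤y = x , here refl , λ { _ (here refl) → ≤-refl ; z (there z∈) → ≤-trans x≤y (min z z∈) }
...   | no x≰y = y , there y∈ , λ { _ (here refl) → ≰⇒≥ x≰y ; z (there z∈) → min z z∈ }

module Graph (m : ℕ) where
  open BooleanIntervals m public

  _—?_ : Decidable _—_
  a —? b = (suc (level a) ≟ level b) ⊎-dec (suc (level b) ≟ level a)

  —-sym : ∀ {a b} → a — b → b — a
  —-sym = Sum.swap

  open Independent _—?_ (λ {a} {b} → —-sym {a} {b}) public

  level-injective : ∀ {i j} → level i < m → level i ≡ level j → i ≡ j
  level-injective {i} {j} lt eq = twist-level-injective (trans (untwisted i lt) (sym (untwisted j (subst (_< m) eq lt)))) eq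
    where
    untwisted : ∀ i → level i < m → twist i ≡ false
    untwisted i lt with twist i in eq
    ... | false = refl
    ... | true = ⊥-elim (<⇒≢ lt (twist-true⇒level≡m i eq))

  level-untwisted : ∀ i → toℕ i ≤ m → level i ≡ toℕ i
  level-untwisted i i≤m with twist i | level i | genView i
  ... | _ | _ | plain _ = refl
  ... | _ | _ | twisted eq = ⊥-elim (1+n≰n (≤-trans (≤-reflexive (sym eq)) i≤m))

  level-twisted : ∀ i → toℕ i ≡ suc m → level i ≡ m
  level-twisted i eq with twist i | level i | genView i
  ... | _ | _ | plain i≤m = ⊥-elim (1+n≰n (≤-trans (≤-reflexive (sym eq)) i≤m))
  ... | _ | _ | twisted _ = refl

  Adj⇒— : ∀ {i j} → Adj n i j → i — j
  Adj⇒— (inj₁ e) = inj₁ (edge e)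
    where
    edge : ∀ {i j} → Edge n i j → suc (level i) ≡ level j
    edge {i} {j} (inj₁ (eq , j<)) = trans (cong suc (level-untwisted i (<⇒≤ (≤-trans (≤-reflexive eq) j≤m))))
      (trans eq (sym (level-untwisted j j≤m)))
      where
      j≤m : toℕ j ≤ m
      j≤m = s≤s⁻¹ (s≤s⁻¹ j<)
    edge {i} {j} (inj₂ (eq , eq′)) = trans (cong suc (level-untwisted i (<⇒≤ (≤-reflexive i≡))))
      (trans i≡ (sym (level-twisted j (suc-injective (trans (+-comm 1 (toℕ j)) eq′)))))
      where
      i≡ : suc (toℕ i) ≡ m
      i≡ = suc-injective (suc-injective (trans (+-comm 3 (toℕ i)) eq))
  Adj⇒— {i} {j} (inj₂ e) = —-sym {j} {i} (Adj⇒— (inj₁ e))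

  —⇒Adj : ∀ {i j} → i — j → Adj n i j
  —⇒Adj {i} {j} (inj₁ eq) = inj₁ (edge i j eq)
    where
    edge : ∀ i j → suc (level i) ≡ level j → Edge n i j
    edge i j eq with twist i | level i | genView i | twist j | level j | genView j | level≤m j
    ... | _ | _ | plain _ | _ | _ | plain j≤m | _ = inj₁ (eq , s≤s (s≤s j≤m))
    ... | _ | _ | plain _ | _ | _ | twisted j≡ | _ =
      inj₂ (trans (+-comm (toℕ i) 3) (cong (λ k → suc (suc k)) eq) , trans (+-comm (toℕ j) 1) (cong suc j≡))
    ... | _ | _ | twisted _ | _ | _ | _ | l≤m = ⊥-elim (1+n≰n (≤-trans (≤-reflexive eq) l≤m))
  —⇒Adj {i} {j} (inj₂ eq) = Sum.swap (—⇒Adj {j} {i} (inj₁ eq))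

  vertex : ∀ l → l ≤ m → ∃ λ i → level i ≡ l
  vertex l l≤m = i , trans (level-untwisted i (subst (_≤ m) (sym i≡) l≤m)) i≡
    where
    i : V
    i = fromℕ< (s≤s (m≤n⇒m≤1+n l≤m))
    i≡ : toℕ i ≡ l
    i≡ = Fin.toℕ-fromℕ< _

  abstract
    top₀ top₁ : V
    top₀ = fromℕ< (s≤s (n≤1+n m))
    top₁ = fromℕ< (n<1+n (suc m))

    toℕ-top₀ : toℕ top₀ ≡ m
    toℕ-top₀ = Fin.toℕ-fromℕ< _

    toℕ-top₁ : toℕ top₁ ≡ suc m
    toℕ-top₁ = Fin.toℕ-fromℕ< (n<1+n (suc m))

  level-top₀ : level top₀ ≡ m
  level-top₀ = trans (level-untwisted top₀ (≤-reflexive toℕ-top₀)) toℕ-top₀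

  level-top₁ : level top₁ ≡ m
  level-top₁ = level-twisted top₁ toℕ-top₁

  top₀≢top₁ : top₀ ≢ top₁
  top₀≢top₁ eq = 1+n≢n (sym (trans (sym toℕ-top₀) (trans (cong toℕ eq) toℕ-top₁)))

  top-cases : ∀ {i} → level i ≡ m → i ≡ top₀ ⊎ i ≡ top₁
  top-cases {i} eq with twist i | level i | genView i
  ... | _ | _ | plain _ = inj₁ (Fin.toℕ-injective (trans eq (sym toℕ-top₀)))
  ... | _ | _ | twisted i≡ = inj₂ (Fin.toℕ-injective (trans i≡ (sym toℕ-top₁)))

  -- The connected induced subgraphs, listed by increasing level; the flag says whether both twins occur at the end.
  data Chain : Bool → Word → Set where
    single : ∀ x → Chain false [ x ]
    fork   : ∀ {x} → suc (level x) ≡ m → Chain true (x ∷ top₀ ∷ top₁ ∷ [])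
    link   : ∀ {b x y zs} → suc (level x) ≡ level y → Chain b (y ∷ zs) → Chain b (x ∷ y ∷ zs)

  chain-< : ∀ {b x xs} → Chain b (x ∷ xs) → All (λ z → level x < level z) xs
  chain-< (single x) = []
  chain-< (fork eq) = ≤-reflexive (trans eq (sym level-top₀)) ∷ ≤-reflexive (trans eq (sym level-top₁)) ∷ []
  chain-< (link eq c) = ≤-reflexive eq ∷ All.map (≤-trans (≤-reflexive eq) ∘ <⇒≤) (chain-< c)

  chain-unique : ∀ {b xs} → Chain b xs → Unique xs
  chain-unique (single x) = [] ∷ []
  chain-unique c@(fork _) = All.map (λ { lt refl → <-irrefl refl lt }) (chain-< c) ∷ (top₀≢top₁ ∷ []) ∷ [] ∷ []
  chain-unique c@(link _ c′) = All.map (λ { lt refl → <-irrefl refl lt }) (chain-< c) ∷ chain-unique c′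

  path-levels : ∀ {xs} → Chain false xs → ∀ {y z} → y ∈ xs → z ∈ xs → level y ≡ level z → y ≡ z
  path-levels _ (here refl) (here refl) _ = refl
  path-levels c (here refl) (there z∈) eq = ⊥-elim (<⇒≢ (All.lookup (chain-< c) z∈) eq)
  path-levels c (there y∈) (here refl) eq = ⊥-elim (<⇒≢ (All.lookup (chain-< c) y∈) (sym eq))
  path-levels (link _ c) (there y∈) (there z∈) eq = path-levels c y∈ z∈ eq

  chainCount : Bool → ℕ → ℕ
  chainCount false k = fib (k + 2)
  chainCount true  k = dseq k

  -- `dseq` obeys the recursion only from index 3 on (d_2 = 4 is not d_1 + d_0); matching on the
  -- chain shows that a forked one is long enough.
  chainCount-rec : ∀ {b y zs} → Chain b (y ∷ zs) →
    chainCount b (2 + length zs) ≡ chainCount b (1 + length zs) + chainCount b (length zs)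
  chainCount-rec {false} _ = refl
  chainCount-rec {true} (fork _) = refl
  chainCount-rec {true} (link _ _) = refl

  ¬—-same : ∀ {a b} → level a ≡ level b → ¬ (a — b)
  ¬—-same eq (inj₁ h) = 1+n≢n (trans h (sym eq))
  ¬—-same eq (inj₂ h) = 1+n≢n (trans h eq)

  count-twins : count all (top₀ ∷ top₁ ∷ []) ≡ 4
  count-twins = cong (λ b → 2 + (1 + (if not b then 1 else 0)))
    (dec-false (top₀ —? top₁) (¬—-same (trans level-top₀ (sym level-top₁))))

  -- All four subsets of the twins avoid `x`, while `x` excludes both twins: 4 + 1, matching d_2 +
  -- d_1.
  count-fork : ∀ {x} → suc (level x) ≡ m → count all (x ∷ top₀ ∷ top₁ ∷ []) ≡ 5
  count-fork {x} eq = cong₂ _+_ count-twins neighbours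
    where
    neighbours : count (without all x) (top₀ ∷ top₁ ∷ []) ≡ 1
    neighbours rewrite dec-true (x —? top₀) (inj₁ (trans eq (sym level-top₀)))
      | dec-true (x —? top₁) (inj₁ (trans eq (sym level-top₁))) = refl

  -- The count of the tail is carried along because the recursion looks back two terms.
  chain-count : ∀ {b x xs} → Chain b (x ∷ xs) →
    count all (x ∷ xs) ≡ chainCount b (suc (length xs)) × count all xs ≡ chainCount b (length xs)
  chain-count (single x) = refl , refl
  chain-count (fork eq) = count-fork eq , count-twins
  chain-count (link {b} {x} {y} {zs} eq c) with chain-count c
  ... | p , q = trans (count-pendant x y zs (inj₁ eq) (All.map far (chain-< c)))
      (trans (cong₂ _+_ p q) (sym (chainCount-rec c))) , p
    where
    far : ∀ {z} → level y < level z → ¬ (x — z)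
    far lt (inj₁ h) = <⇒≢ lt (trans (sym eq) h)
    far {z} lt (inj₂ h) = <-asym lt (≤-trans (≤-reflexive h) (≤-trans (n≤1+n _) (≤-reflexive eq)))

  -- Shape of the connected components

  module Components {T : V → Set} (T? : ∀ x → Dec (T x)) where
    open Induced n T

    -- Closure is demanded upwards only: chains grow upwards from `x`, and an exit below `x` is
    -- ruled out later by the minimality of its level.
    Closed : V → Word → Set
    Closed x K = ∀ {z y} → z ∈ K → T y → z — y → y ∈ K ⊎ level y < level x

    module _ {C : Word} (comp : IsComponent C) where

      C-unique : Unique C
      C-unique = proj₁ comp

      C-T : ∀ {x} → x ∈ C → T x
      C-T = proj₁ (proj₂ (proj₂ comp)) _

      C-closed : ∀ {x y} → x ∈ C → T y → x — y → y ∈ C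
      C-closed x∈ Ty x—y = proj₂ (proj₂ (proj₂ (proj₂ comp))) _ _ x∈ Ty (—⇒Adj x—y)

      Growth : V → Set
      Growth x = ∃₂ λ b zs → Chain b (x ∷ zs) × All (_∈ C) (x ∷ zs) × Closed x (x ∷ zs)

      grow-top : ∀ {x} → x ∈ C → level x ≡ m → Growth x
      grow-top {x} x∈ lx≡m = false , [] , single x , x∈ ∷ [] , closed
        where
        closed : Closed x [ x ]
        closed {y = y} (here refl) _ (inj₁ eq) = ⊥-elim (<⇒≱ (≤-reflexive (cong suc (sym lx≡m))) (≤-trans (≤-reflexive eq) (level≤m y)))
        closed (here refl) _ (inj₂ eq) = inj₂ (≤-reflexive eq)

      below-top : ∀ {x y z} → suc (level x) ≡ m → level z ≡ m → z — y → y ≡ x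
      below-top {y = y} eq lz≡m (inj₁ h) = ⊥-elim (<⇒≱ (≤-reflexive (cong suc (sym lz≡m))) (≤-trans (≤-reflexive h) (level≤m y)))
      below-top {x} {y} {z} eq lz≡m (inj₂ h) = level-injective (≤-reflexive (trans h lz≡m))
        (suc-injective (trans h (trans lz≡m (sym eq))))

      grow-fork : ∀ {x} → x ∈ C → suc (level x) ≡ m → Growth x
      grow-fork {x} x∈ eq = go (T? top₀) (T? top₁)
        where
        up₀ : suc (level x) ≡ level top₀
        up₀ = trans eq (sym level-top₀)
        up₁ : suc (level x) ≡ level top₁
        up₁ = trans eq (sym level-top₁)
        closed : ∀ K → x ∈ K → (∀ {z} → z ∈ K → z ≡ x ⊎ level z ≡ m) →
          (T top₀ → top₀ ∈ K) → (T top₁ → top₁ ∈ K) → Closed x K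
        closed K x∈K levels has₀ has₁ z∈ Ty z—y with levels z∈
        ... | inj₂ lz≡m = inj₁ (subst (_∈ K) (sym (below-top eq lz≡m z—y)) x∈K)
        closed K x∈K levels has₀ has₁ z∈ Ty (inj₂ h) | inj₁ refl = inj₂ (≤-reflexive h)
        closed K x∈K levels has₀ has₁ z∈ Ty (inj₁ h) | inj₁ refl with top-cases (trans (sym h) eq)
        ... | inj₁ refl = inj₁ (has₀ Ty)
        ... | inj₂ refl = inj₁ (has₁ Ty)
        go : Dec (T top₀) → Dec (T top₁) → Growth x
        go (no ¬t₀) (no ¬t₁) = false , [] , single x , x∈ ∷ [] ,
          closed [ x ] (here refl) (λ { (here refl) → inj₁ refl }) (⊥-elim ∘ ¬t₀) (⊥-elim ∘ ¬t₁)
        go (yes t₀) (no ¬t₁) = false , [ top₀ ] , link up₀ (single top₀) , x∈ ∷ C-closed x∈ t₀ (inj₁ up₀) ∷ [] ,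
          closed (x ∷ [ top₀ ]) (here refl) (λ { (here refl) → inj₁ refl ; (there (here refl)) → inj₂ level-top₀ })
            (λ _ → there (here refl)) (⊥-elim ∘ ¬t₁)
        go (no ¬t₀) (yes t₁) = false , [ top₁ ] , link up₁ (single top₁) , x∈ ∷ C-closed x∈ t₁ (inj₁ up₁) ∷ [] ,
          closed (x ∷ [ top₁ ]) (here refl) (λ { (here refl) → inj₁ refl ; (there (here refl)) → inj₂ level-top₁ })
            (⊥-elim ∘ ¬t₀) (λ _ → there (here refl))
        go (yes t₀) (yes t₁) = true , top₀ ∷ [ top₁ ] , fork eq ,
          x∈ ∷ C-closed x∈ t₀ (inj₁ up₀) ∷ C-closed x∈ t₁ (inj₁ up₁) ∷ [] ,
          closed (x ∷ top₀ ∷ [ top₁ ]) (here refl)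
            (λ { (here refl) → inj₁ refl ; (there (here refl)) → inj₂ level-top₀ ; (there (there (here refl))) → inj₂ level-top₁ })
            (λ _ → there (here refl)) (λ _ → there (there (here refl)))

      -- `d` is the distance to the level of the twins. At distance two or more there is exactly one
      -- vertex on the next level, so the chain stops or continues; branching is possible only at
      -- distance one.
      grow : ∀ d {x} → x ∈ C → level x + d ≡ m → Growth x
      grow zero {x} x∈ eq = grow-top x∈ (trans (sym (+-identityʳ (level x))) eq)
      grow (suc zero) {x} x∈ eq = grow-fork x∈ (trans (+-comm 1 (level x)) eq)
      grow (suc (suc d)) {x} x∈ eq = go (T? y)
          (λ Ty → grow (suc d) {y} (C-closed x∈ Ty (inj₁ (sym ly≡))) (trans (cong (_+ suc d) ly≡) eq′))
        where
        eq′ : suc (level x) + suc d ≡ m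
        eq′ = trans (sym (+-suc (level x) (suc d))) eq
        1+lx<m : suc (level x) < m
        1+lx<m = subst (suc (suc (level x)) ≤_) (trans (sym (+-suc (suc (level x)) d)) eq′) (m≤m+n (suc (suc (level x))) d)
        above : ∃ λ y → level y ≡ suc (level x)
        above = vertex (suc (level x)) (<⇒≤ 1+lx<m)
        y : V
        y = proj₁ above
        ly≡ : level y ≡ suc (level x)
        ly≡ = proj₂ above
        unique-above : ∀ {z} → suc (level x) ≡ level z → z ≡ y
        unique-above h = level-injective (subst (_< m) h 1+lx<m) (trans (sym h) (sym ly≡))
        go : Dec (T y) → (T y → Growth y) → Growth x
        go (no ¬Ty) _ = false , [] , single x , x∈ ∷ [] , closed
          where
          closed : Closed x [ x ]
          closed (here refl) Tz (inj₁ h) = ⊥-elim (¬Ty (subst T (unique-above h) Tz))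
          closed (here refl) _ (inj₂ h) = inj₂ (≤-reflexive h)
        go (yes Ty) rest with rest Ty
        ... | b , zs , chain , zs∈ , closed = b , y ∷ zs , link (sym ly≡) chain , x∈ ∷ zs∈ , closed′
          where
          closed′ : Closed x (x ∷ y ∷ zs)
          closed′ (here refl) _ (inj₁ h) = inj₁ (there (here (unique-above h)))
          closed′ (here refl) _ (inj₂ h) = inj₂ (≤-reflexive h)
          closed′ {y = w} (there z∈) Tw z—w with closed z∈ Tw z—w
          ... | inj₁ w∈ = inj₁ (there w∈)
          ... | inj₂ lw<ly with level w ≟ level x
          ...   | yes lw≡lx = inj₁ (here (level-injective (subst (_< m) (sym lw≡lx) (<⇒≤ 1+lx<m)) lw≡lx))
          ...   | no lw≢lx = inj₂ (≤∧≢⇒< (s≤s⁻¹ (≤-trans lw<ly (≤-reflexive ly≡))) lw≢lx)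

      -- The chain is grown from a vertex of minimal level. A walk from that vertex cannot leave the
      -- chain, since an exit would reach a vertex of `C` of still lower level; so the chain is all
      -- of `C`.
      component-chain : ∃₂ λ b K → Chain b K × C ↭ K
      component-chain with minimum-by level C (proj₂ (proj₁ (proj₂ comp)))
      ... | x , x∈ , min with grow (m ∸ level x) x∈ (m+[n∸m]≡n (level≤m x))
      ...   | b , zs , chain , zs∈ , closed = b , K , chain , unique-set⇒↭ C-unique (chain-unique chain)
          (λ y∈ → reach (proj₁ (proj₂ (proj₂ (proj₂ comp))) x _ x∈ y∈) (here refl)) (All.lookup zs∈)
        where
        K : Word
        K = x ∷ zs
        source : ∀ {z y} → Conn z y → T z
        source (here Tz) = Tz
        source (step Tz _ _) = Tz
        reach : ∀ {z y} → Conn z y → z ∈ K → y ∈ K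
        reach (here _) z∈ = z∈
        reach (step _ adj conn) z∈ with closed z∈ (source conn) (Adj⇒— adj)
        ... | inj₁ w∈ = reach conn w∈
        ... | inj₂ lw<lx = ⊥-elim (<⇒≱ lw<lx (min _ (C-closed (All.lookup zs∈ z∈) (source conn) (Adj⇒— adj))))

    -- Of three neighbours two lie on the same side, hence on the same level. Only the top level
    -- holds two vertices, so these are the twins and `x` lies just below them.
    Deg3⇒fork : ∀ {x} → Deg3 x → suc (level x) ≡ m × T top₀ × T top₁
    Deg3⇒fork {x} (Tx , a ∷ b ∷ c ∷ [] , (a≢b ∷ a≢c ∷ []) ∷ (b≢c ∷ []) ∷ [] ∷ [] , refl , nb) = go
      (side a (here refl)) (side b (there (here refl))) (side c (there (there (here refl))))
      where
      L : Word
      L = a ∷ b ∷ c ∷ []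
      Result : Set
      Result = suc (level x) ≡ m × T top₀ × T top₁
      side : ∀ y → y ∈ L → T y × x — y
      side y y∈ with Equivalence.to (nb y) y∈
      ... | Ty , adj = Ty , Adj⇒— adj
      twins : ∀ {p q} → p ≢ q → level p ≡ level q → T p → T q → x — p → Result
      twins {p} {q} p≢q eq Tp Tq x—p = low x—p , both (top-cases lp≡m) (top-cases (trans (sym eq) lp≡m))
        where
        lp≡m : level p ≡ m
        lp≡m = ≤-antisym (level≤m p) (≮⇒≥ (λ lt → p≢q (level-injective lt eq)))
        low : x — p → suc (level x) ≡ m
        low (inj₁ h) = trans h lp≡m
        low (inj₂ h) = ⊥-elim (<⇒≱ (≤-reflexive (trans (cong suc (sym lp≡m)) h)) (level≤m x))
        both : p ≡ top₀ ⊎ p ≡ top₁ → q ≡ top₀ ⊎ q ≡ top₁ → T top₀ × T top₁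
        both (inj₁ refl) (inj₁ refl) = ⊥-elim (p≢q refl)
        both (inj₁ refl) (inj₂ refl) = Tp , Tq
        both (inj₂ refl) (inj₁ refl) = Tq , Tp
        both (inj₂ refl) (inj₂ refl) = ⊥-elim (p≢q refl)
      go : T a × x — a → T b × x — b → T c × x — c → Result
      go (Ta , A@(inj₁ h)) (Tb , inj₁ h′) _ = twins a≢b (trans (sym h) h′) Ta Tb A
      go (Ta , A@(inj₂ h)) (Tb , inj₂ h′) _ = twins a≢b (suc-injective (trans h (sym h′))) Ta Tb A
      go (Ta , A@(inj₁ h)) (_ , inj₂ _) (Tc , inj₁ h′) = twins a≢c (trans (sym h) h′) Ta Tc A
      go (Ta , A@(inj₂ h)) (_ , inj₁ _) (Tc , inj₂ h′) = twins a≢c (suc-injective (trans h (sym h′))) Ta Tc A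
      go (_ , inj₂ _) (Tb , B@(inj₁ h)) (Tc , inj₁ h′) = twins b≢c (trans (sym h) h′) Tb Tc B
      go (_ , inj₁ _) (Tb , B@(inj₂ h)) (Tc , inj₂ h′) = twins b≢c (suc-injective (trans h (sym h′))) Tb Tc B

    fork⇒Deg3 : ∀ {x z} → suc (level z) ≡ level x → suc (level x) ≡ m → T z → T x → T top₀ → T top₁ → Deg3 x
    fork⇒Deg3 {x} {z} z↗x x↗m Tz Tx T₀ T₁ = Tx , L , unique , refl , λ y → mk⇔ to (from y)
      where
      L : Word
      L = z ∷ top₀ ∷ top₁ ∷ []
      lz<m : level z < m
      lz<m = ≤-trans (≤-reflexive z↗x) (≤-trans (n≤1+n _) (≤-reflexive x↗m))
      z≢top : ∀ {t} → level t ≡ m → z ≢ t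
      z≢top lt refl = <⇒≢ lz<m lt
      unique : Unique L
      unique = (z≢top level-top₀ ∷ z≢top level-top₁ ∷ []) ∷ (top₀≢top₁ ∷ []) ∷ [] ∷ []
      to : ∀ {y} → y ∈ L → T y × Adj n x y
      to (here refl) = Tz , —⇒Adj {x} {z} (inj₂ z↗x)
      to (there (here refl)) = T₀ , —⇒Adj {x} {top₀} (inj₁ (trans x↗m (sym level-top₀)))
      to (there (there (here refl))) = T₁ , —⇒Adj {x} {top₁} (inj₁ (trans x↗m (sym level-top₁)))
      from : ∀ y → T y × Adj n x y → y ∈ L
      from y (_ , adj) with Adj⇒— adj
      ... | inj₂ h = here (sym (level-injective lz<m (suc-injective (trans z↗x (sym h)))))
      ... | inj₁ h with top-cases (trans (sym h) x↗m)
      ...   | inj₁ refl = there (here refl)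
      ...   | inj₂ refl = there (there (here refl))

    long-fork : ∀ {x y zs} → suc (level x) ≡ level y → Chain true (y ∷ zs) → All T (x ∷ y ∷ zs) →
      ∃ λ z → Deg3 z × z ∈ x ∷ y ∷ zs
    long-fork {y = y} eq (fork eq′) (Tx ∷ Ty ∷ T₀ ∷ T₁ ∷ []) = y , fork⇒Deg3 eq eq′ Tx Ty T₀ T₁ , there (here refl)
    long-fork eq (link eq′ c) (_ ∷ Tzs) with long-fork eq′ c Tzs
    ... | z , deg , z∈ = z , deg , there z∈

    -- A vertex of degree three brings both twins into its component, while a path has one vertex
    -- per level; so the chain is forked. The empty component contributes the empty set only, which
    -- is d_0.
    count-b₀ : ∀ {b₀} → IsB0 b₀ → count all b₀ ≡ dseq (length b₀)
    count-b₀ (inj₂ (_ , refl)) = refl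
    count-b₀ {b₀} (inj₁ (x , deg , x∈ , comp)) with component-chain comp
    ... | true , K@(_ ∷ _) , chain , p =
      trans (count-↭ all p) (trans (proj₁ (chain-count chain)) (cong dseq (sym (↭-length p))))
    ... | false , K , chain , p with Deg3⇒fork deg
    ...   | x↗m , T₀ , T₁ = ⊥-elim (top₀≢top₁ (path-levels chain
      (∈-resp-↭ p (C-closed comp x∈ T₀ (inj₁ (trans x↗m (sym level-top₀)))))
      (∈-resp-↭ p (C-closed comp x∈ T₁ (inj₁ (trans x↗m (sym level-top₁)))))
      (trans level-top₀ (sym level-top₁))))

    Deg3-unique : ∀ {x y} → Deg3 x → Deg3 y → x ≡ y
    Deg3-unique dx dy with Deg3⇒fork dx | Deg3⇒fork dy
    ... | x↗m , _ | y↗m , _ = level-injective (≤-reflexive x↗m) (suc-injective (trans x↗m (sym y↗m)))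

    no-Deg3 : ∀ {b₀ c x} → IsB0 b₀ → Disjoint b₀ c → x ∈ c → ¬ Deg3 x
    no-Deg3 (inj₁ (y , deg , y∈ , _)) disj x∈ deg′ = disj y y∈ (subst (_∈ _) (Deg3-unique deg′ deg) x∈)
    no-Deg3 (inj₂ (none , _)) _ _ deg = none (_ , deg)

    -- A forked chain with more than three vertices has a vertex of degree three. There is at most
    -- one such vertex, and it lies in `b₀`.
    count-rest : ∀ {b₀ c} → IsB0 b₀ → Disjoint b₀ c → IsComponent c → count all c ≡ fib (length c + 2)
    count-rest isb₀ disj comp with component-chain comp
    ... | false , K@(_ ∷ _) , chain , p =
      trans (count-↭ all p) (trans (proj₁ (chain-count chain)) (cong (λ k → fib (k + 2)) (sym (↭-length p))))
    -- A fork with three vertices is a path through its first entry; the count passes from `dseq 3`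
    -- to `fib 5` because both compute to 5.
    ... | true , _ , chain@(fork _) , p =
      trans (count-↭ all p) (trans (proj₁ (chain-count chain)) (cong (λ k → fib (k + 2)) (sym (↭-length p))))
    ... | true , _ , link eq chain , p with long-fork eq chain (All-resp-↭ p (All.tabulate (C-T comp)))
    ...   | z , deg , z∈ = ⊥-elim (no-Deg3 isb₀ disj (∈-resp-↭ (↭-sym p) z∈) deg)

    component-apart : ∀ {C ys} → IsComponent C → Disjoint C ys → All T ys → All (λ x → All (λ y → ¬ x — y) ys) C
    component-apart comp disj Tys = All.tabulate (λ x∈ → All.tabulate (λ y∈ x—y →
      disj _ (C-closed comp x∈ (All.lookup Tys y∈) x—y) y∈))

AllPairs-resp-⊑ : ∀ {A : Set} {R : A → A → Set} {xs ys} → xs ⊑ ys → AllPairs R ys → AllPairs R xs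
AllPairs-resp-⊑ Sublist.[] [] = []
AllPairs-resp-⊑ (_ Sublist.∷ʳ s) (_ ∷ pys) = AllPairs-resp-⊑ s pys
AllPairs-resp-⊑ (refl Sublist.∷ s) (py ∷ pys) = All-resp-⊆ s py ∷ AllPairs-resp-⊑ s pys

-- Product formula over the components

module Decomposition (m : ℕ) {T : Fin (suc (suc m)) → Set} (T? : ∀ x → Dec (T x)) where
  open Graph m public
  open Components T? public
  open Induced n T public

  restCount : List Word → ℕ
  restCount bs = product (map (λ b → fib (length b + 2)) bs)

  Disjoint-concat : ∀ {c cs} → All (Disjoint c) cs → Disjoint c (concat cs)
  Disjoint-concat {cs = cs} disj x x∈c x∈cs with ∈-concat⁻′ cs x∈cs
  ... | d , x∈d , d∈ = All.lookup disj d∈ x x∈c x∈d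

  All-T-concat : ∀ {bs} → All IsComponent bs → All T (concat bs)
  All-T-concat comps = All.concat⁺ (All.map (λ comp → All.tabulate (C-T comp)) comps)

  count-concat : ∀ {b₀ bs} → IsB0 b₀ → All (Disjoint b₀) bs → All IsComponent bs → AllPairs Disjoint bs →
    count all (concat bs) ≡ restCount bs
  count-concat {bs = []} _ _ _ _ = refl
  count-concat {bs = c ∷ cs} isb₀ (d ∷ ds) (comp ∷ comps) (disj ∷ disjs) = trans
    (count-++ all c (concat cs) (component-apart comp (Disjoint-concat disj) (All-T-concat comps)))
    (cong₂ _*_ (count-rest isb₀ d comp) (count-concat isb₀ ds comps disjs))

  vertices : Word → List Word → Word
  vertices b₀ bs = b₀ ++ concat bs

  module _ {b₀ bs} (isb₀ : IsB0 b₀) (isRest : IsRest b₀ bs) where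

    private
      comps : All IsComponent bs
      comps = proj₁ isRest

      b₀-disjoint : Disjoint b₀ (concat bs)
      b₀-disjoint = Disjoint-concat (proj₁ (proj₂ (proj₂ isRest)))

    count-vertices : count all (vertices b₀ bs) ≡ dseq (length b₀) * restCount bs
    count-vertices = trans (count-++ all b₀ (concat bs) (apart isb₀ b₀-disjoint))
      (cong₂ _*_ (count-b₀ isb₀) (count-concat isb₀ (proj₁ (proj₂ (proj₂ isRest))) comps (proj₁ (proj₂ isRest))))
      where
      apart : ∀ {b₀} → IsB0 b₀ → Disjoint b₀ (concat bs) → All (λ x → All (λ y → ¬ x — y) (concat bs)) b₀
      apart (inj₁ (_ , _ , _ , comp)) disj = component-apart comp disj (All-T-concat comps)
      apart (inj₂ (_ , refl)) _ = []

    vertices-unique : Unique (vertices b₀ bs)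
    vertices-unique = Unique.++⁺ (b₀-unique isb₀)
      (Unique.concat⁺ (All.map proj₁ comps) (AllPairs.map (λ d {_} (x∈ , x∈′) → d _ x∈ x∈′) (proj₁ (proj₂ isRest))))
      (λ (x∈ , x∈′) → b₀-disjoint _ x∈ x∈′)
      where
      b₀-unique : ∀ {b₀} → IsB0 b₀ → Unique b₀
      b₀-unique (inj₁ (_ , _ , _ , comp)) = proj₁ comp
      b₀-unique (inj₂ (_ , refl)) = []

    vertices-T : All T (vertices b₀ bs)
    vertices-T = All.++⁺ (b₀-T isb₀) (All-T-concat comps)
      where
      b₀-T : ∀ {b₀} → IsB0 b₀ → All T b₀
      b₀-T (inj₁ (_ , _ , _ , comp)) = All.tabulate (C-T comp)
      b₀-T (inj₂ (_ , refl)) = []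

    ∈-vertices : ∀ {x} → T x → x ∈ vertices b₀ bs
    ∈-vertices {x} Tx with proj₂ (proj₂ (proj₂ isRest)) x Tx
    ... | inj₁ x∈ = ∈-++⁺ˡ x∈
    ... | inj₂ x∈ = ∈-++⁺ʳ b₀ (∈-concat⁺ x∈)

-- Boolean intervals listed by independent sets of ascents

module Enumeration (m : ℕ) where
  open Graph m

  enumerate : Word → Word → List El
  enumerate r L = map (λ J → el (r ++ J)) (independents all L)

  module _ {r L : Word} (red : Reduced r) (uL : Unique L)
    (sound : Ascents r L) (complete : ∀ {x} → ascent r x ≡ true → x ∈ L) where

    independent⇒far : ∀ {J} → J ∈ independents all L → Far J × Ascents r J
    independent⇒far J∈ with independents-sound all L J∈
    ... | J⊑L , _ , apart = AllPairs.zip (AllPairs-resp-⊑ J⊑L uL , apart) ,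
      All.tabulate (λ x∈ → All.lookup sound (Sublist.lookup J⊑L x∈))

    el-injective : ∀ {J K} → J ∈ independents all L → K ∈ independents all L → el (r ++ J) ≡ el (r ++ K) → J ≡ K
    el-injective {J} {K} J∈ K∈ eq = sublist-↭⇒≡ uL (proj₁ (independents-sound all L J∈)) (proj₁ (independents-sound all L K∈))
      (reduced-word-far (proj₁ (independent⇒far K∈))
        (reduced-++ʳ r J (reduced-far red (proj₂ (independent⇒far J∈)) (proj₁ (independent⇒far J∈))))
        (++-cancelˡ-≋ r (el≡⇒≋ eq)))

    enumerate-unique : Unique (enumerate r L)
    enumerate-unique = unique-map⁺ el-injective (independents-unique all L uL)

    -- `K` comes in an arbitrary order. Filtering `L` by membership in `K` gives the sublist of `L`
    -- with the same letters, and commuting letters may be rearranged.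
    far∈enumerate : ∀ {K} → Far K → Ascents r K → el (r ++ K) ∈ enumerate r L
    far∈enumerate {K} far asc = subst (_∈ enumerate r L) (≋⇒el≡ (++-congˡ r (≋-sym (↭⇒≋ far K↭J))))
      (∈-map⁺ (λ J → el (r ++ J)) (independents-complete all L (filter-⊆ in? L) (All.universal (λ _ → refl) (filter in? L))
        (AllPairs.map proj₂ (AllPairs-resp-↭ ⌿-sym K↭J far))))
      where
      in? : ∀ x → Dec (x ∈ K)
      in? x = _∈?_ Fin._≟_ x K
      K↭J : K ↭ filter in? L
      K↭J = unique-set⇒↭ (Far⇒Unique far) (Unique.filter⁺ in? uL)
        (λ x∈ → ∈-filter⁺ in? (complete (All.lookup asc x∈)) x∈) (λ x∈ → proj₂ (∈-filter⁻ in? {xs = L} x∈))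

    ∈-enumerate : ∀ w → (w ∈ enumerate r L) ⇔ (WLe n (el r) w × BooleanInterval n (el r) w)
    ∈-enumerate w = mk⇔ to from
      where
      to : w ∈ enumerate r L → WLe n (el r) w × BooleanInterval n (el r) w
      to w∈ with ∈-map⁻ (λ J → el (r ++ J)) w∈
      ... | J , J∈ , refl = far⇒WLe red far asc , far⇒Boolean red far asc
        where
        far : Far J
        far = proj₁ (independent⇒far J∈)
        asc : Ascents r J
        asc = proj₂ (independent⇒far J∈)
      from : WLe n (el r) w × BooleanInterval n (el r) w → w ∈ enumerate r L
      from (le , boolean) = conclude (Boolean⇒far red le boolean)
        where
        conclude : (∃ λ K → Far K × Ascents r K × w ≡ el (r ++ K)) → w ∈ enumerate r L
        conclude (K , far , asc , eq) = subst (_∈ enumerate r L) (sym eq) (far∈enumerate far asc)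

module Count (m : ℕ) where
  open Graph m
  open Enumeration m

  Counted : El → Set
  Counted v = ∀ b₀ bs → Induced.IsB0 n (NonDes n v) b₀ → Induced.IsRest n (NonDes n v) b₀ bs →
    ∃ λ ws → Unique ws × (∀ w → (w ∈ ws) ⇔ (WLe n v w × BooleanInterval n v w)) ×
    length ws ≡ dseq (length b₀) * product (map (λ b → fib (length b + 2)) bs)

  module _ {r : Word} (red : Reduced r) where

    -- Descents are defined by lengths, which quantify over all words; the sign of one root decides
    -- them.
    nonDes? : ∀ x → Dec (NonDes n (el r) x)
    nonDes? x = map′ (Equivalence.from (NonDes⇔ascent red x)) (Equivalence.to (NonDes⇔ascent red x)) (ascent r x Bool.≟ true)

    open Decomposition m nonDes? using (vertices; vertices-unique; vertices-T; ∈-vertices; count-vertices)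

    counted : Counted (el r)
    counted b₀ bs isb₀ isRest = enumerate r L , enumerate-unique red uL sound complete , ∈-enumerate red uL sound complete ,
      trans (length-map (λ J → el (r ++ J)) (independents all L))
        (trans (length-independents all L) (count-vertices isb₀ isRest))
      where
      L : Word
      L = vertices b₀ bs
      uL : Unique L
      uL = vertices-unique isb₀ isRest
      sound : Ascents r L
      sound = All.map (λ {x} → Equivalence.to (NonDes⇔ascent red x)) (vertices-T isb₀ isRest)
      complete : ∀ {x} → ascent r x ≡ true → x ∈ L
      complete {x} asc = ∈-vertices isb₀ isRest (Equivalence.from (NonDes⇔ascent red x) asc)

  counted-prod : ∀ us → Counted (prod n us)
  counted-prod us = conclude (normalise us)
    where
    conclude : (∃ λ r → Reduced r × r ≋ us) → Counted (prod n us)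
    conclude (r , red , r≋us) = subst Counted (trans (≋⇒el≡ r≋us) (el≡prod us)) (counted red)

theorem3p13 : (n : ℕ) → 2 ≤ n → (v : El) → InW n v →
    (b0 : List (Fin n)) (bs : List (List (Fin n))) →
    Induced.IsB0 n (NonDes n v) b0 →
    Induced.IsRest n (NonDes n v) b0 bs →
    ∃ λ (ws : List El) → Unique ws ×
    (∀ w → (w ∈ ws) ⇔ (WLe n v w × BooleanInterval n v w)) ×
    length ws ≡ dseq (length b0) * product (map (λ b → fib (length b + 2)) bs)
theorem3p13 (suc (suc m)) (s≤s (s≤s _)) _ (us , refl) = Count.counted-prod m us
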